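{- Let $T$ be a tree with $n\ge 2$ vertices. Then $$F(T)\geq \prod_{v\in V(T)} d(v)!,$$ where $d(v)$ is the degree of $v$ in $T$. Equality holds if and only if $T$ is a path of length $n-1$ or a star.
   Context: For a finite undirected graph $G=(V,E)$, a shelling of $G$ is a total ordering $\sigma(1),\ldots,\sigma(|E|)$ of $E$ such that for every $k=1,\ldots,|E|$ the edges $\sigma(1),\ldots,\sigma(k)$ form a connected subgraph of $G$; $F(G)$ is the number of shellings of $G$. -}

module Defs where

open import Data.Nat using (ℕ; suc; _≤_; _!)
open import Data.Nat.ListAction using (product)
import Data.Nat.Properties as ℕ
open import Data.Fin using (Fin; toℕ; _<_)
open import Data.Fin.Properties using (_≟_; _<?_; all?)
open import Data.Fin.Permutation using (Permutation′; _⟨$⟩ʳ_)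
open import Data.List using
  (List; []; _∷_; _∷ʳ_; _++_; [_]; length; map; filter; concatMap; take; allFin; cartesianProduct)
open import Data.List.Membership.Propositional using (_∈_; _∉_; find; lose)
open import Data.List.Membership.Propositional.Properties using
  (∈-map⁺; ∈-map⁻; ∈-filter⁺; ∈-filter⁻; ∈-concatMap⁺; ∈-concatMap⁻; ∈-∃++)
open import Data.List.Relation.Binary.Permutation.Propositional using
  (_↭_; ↭-refl; ↭-sym; ↭-trans; prep; swap)
open import Data.List.Relation.Binary.Permutation.Propositional.Properties using
  (∈-resp-↭; drop-mid; ↭-empty-inv)
open import Data.List.Relation.Unary.All as All using (All)
open import Data.List.Relation.Unary.AllPairs using ([]; _∷_)
open import Data.List.Relation.Unary.Any using (Any; here; there; any?)
open import Data.List.Relation.Unary.Linked using (Linked)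
open import Data.List.Relation.Unary.Unique.Propositional using (Unique)
open import Data.List.Relation.Unary.Unique.Propositional.Properties as Unique
  using (Unique[x∷xs]⇒x∉xs)
open import Data.Product using (Σ; _×_; _,_; proj₁; proj₂)
open import Data.Sum as Sum using (_⊎_; inj₁; inj₂)
open import Function using (_⇔_; mk⇔; _∘_)
open import Level using (0ℓ)
open import Relation.Binary using (Rel; Decidable; Symmetric; Irreflexive)
open import Relation.Binary.Construct.Closure.ReflexiveTransitive as Star
  using (Star; ε; _◅_; _◅◅_)
open import Relation.Binary.PropositionalEquality using (_≡_; _≢_; refl; sym; cong)
open import Relation.Nullary using (Dec; ¬_; contradiction)
open import Relation.Nullary.Decidable using (map′; ¬?; _×-dec_; _⊎-dec_; _→-dec_)

record Graph (n : ℕ) : Set₁ where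
  field
    Adj    : Rel (Fin n) 0ℓ
    adj?   : Decidable Adj
    symm   : Symmetric Adj
    irrefl : Irreflexive _≡_ Adj

open Graph

IsConnected : ∀ {n} → Graph n → Set
IsConnected G = ∀ u v → Star (Adj G) u v

-- The cycle v, v₁, …, vₘ, v, where vs = v₁, …, vₘ and m ≥ 2.
IsCycle : ∀ {n} → Graph n → Fin n → List (Fin n) → Set
IsCycle G v vs =
  2 ≤ length vs × Unique (v ∷ vs) × Linked (Adj G) (v ∷ (vs ∷ʳ v))

IsAcyclic : ∀ {n} → Graph n → Set
IsAcyclic G = ∀ v vs → ¬ IsCycle G v vs

IsTree : ∀ {n} → Graph n → Set
IsTree G = IsConnected G × IsAcyclic G

degree : ∀ {n} → Graph n → Fin n → ℕ
degree {n} G v = length (filter (adj? G v) (allFin n))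

∏degree! : ∀ {n} → Graph n → ℕ
∏degree! {n} G = product (map (λ v → degree G v !) (allFin n))

infix 4 _≅_

_≅_ : ∀ {n} → Graph n → Graph n → Set
_≅_ {n} G H = Σ (Permutation′ n) λ π →
  ∀ u v → Adj G u v ⇔ Adj H (π ⟨$⟩ʳ u) (π ⟨$⟩ʳ v)

-- The path 0 – 1 – ⋯ – (n-1), which for n ≥ 1 has length n - 1.
pathGraph : ∀ n → Graph n
pathGraph n = record
  { Adj    = λ i j → toℕ j ≡ suc (toℕ i) ⊎ toℕ i ≡ suc (toℕ j)
  ; adj?   = λ i j → (toℕ j ℕ.≟ suc (toℕ i)) ⊎-dec (toℕ i ℕ.≟ suc (toℕ j))
  ; symm   = Sum.swap
  ; irrefl = λ { refl (inj₁ p) → ℕ.1+n≢n (sym p) ; refl (inj₂ p) → ℕ.1+n≢n (sym p) }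
  }

-- The star with centre 0.
starGraph : ∀ n → Graph n
starGraph n = record
  { Adj    = λ i j → (toℕ i ≡ 0 × toℕ j ≢ 0) ⊎ (toℕ j ≡ 0 × toℕ i ≢ 0)
  ; adj?   = λ i j → ((toℕ i ℕ.≟ 0) ×-dec ¬? (toℕ j ℕ.≟ 0))
               ⊎-dec ((toℕ j ℕ.≟ 0) ×-dec ¬? (toℕ i ℕ.≟ 0))
  ; symm   = Sum.swap
  ; irrefl = λ { refl (inj₁ (p , q)) → q p ; refl (inj₂ (p , q)) → q p }
  }

IsPath : ∀ {n} → Graph n → Set
IsPath {n} G = G ≅ pathGraph n

IsStar : ∀ {n} → Graph n → Set
IsStar {n} G = G ≅ starGraph n

Edge : ℕ → Set
Edge n = Fin n × Fin n

-- The undirected edge {i , j} is represented once, by the pair with i < j.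
edges : ∀ {n} → Graph n → List (Edge n)
edges {n} G = filter (λ (i , j) → (i <? j) ×-dec adj? G i j)
                     (cartesianProduct (allFin n) (allFin n))

Covered : ∀ {n} → List (Edge n) → Fin n → Set
Covered es u = Any (λ (i , j) → u ≡ i ⊎ u ≡ j) es

Joined : ∀ {n} → List (Edge n) → Rel (Fin n) 0ℓ
Joined es u v = (u , v) ∈ es ⊎ (v , u) ∈ es

-- The subgraph formed by es has the endpoints of es as its vertices, so
-- vertices lying on no edge of es play no role.
FormConnected : ∀ {n} → List (Edge n) → Set
FormConnected es = ∀ u v → Covered es u → Covered es v → Star (Joined es) u v

-- With k : Fin (length σ), the number 1 + k ranges over 1, …, |E|.
PrefixesConnected : ∀ {n} → List (Edge n) → Set
PrefixesConnected σ = ∀ (k : Fin (length σ)) → FormConnected (take (suc (toℕ k)) σ)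

IsShelling : ∀ {n} → Graph n → List (Edge n) → Set
IsShelling G σ = σ ↭ edges G × PrefixesConnected σ

private
  weaken : ∀ {n} e {es : List (Edge n)} {u v} →
           Star (Joined es) u v → Star (Joined (e ∷ es)) u v
  weaken e = Star.map (Sum.map there there)

-- Reachability using one more edge {a , b}, in terms of reachability without it.
reachable? : ∀ {n} (es : List (Edge n)) → Decidable (Star (Joined es))
reachable? []             u v = map′ (λ { refl → ε }) nil (u ≟ v)
  where
  nil : Star (Joined []) u v → u ≡ v
  nil ε             = refl
  nil (inj₁ () ◅ _)
  nil (inj₂ () ◅ _)
reachable? ((a , b) ∷ es) u v = map′ to from
  (  reachable? es u v
  ⊎-dec (reachable? es u a ×-dec reachable? es b v)
  ⊎-dec (reachable? es u b ×-dec reachable? es a v))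
  where
  Split : Fin _ → Set
  Split w = Star (Joined es) w v
          ⊎ (Star (Joined es) w a × Star (Joined es) b v)
          ⊎ (Star (Joined es) w b × Star (Joined es) a v)

  w⁺ : ∀ {x y} → Star (Joined es) x y → Star (Joined ((a , b) ∷ es)) x y
  w⁺ = weaken (a , b)

  to : Split u → Star (Joined ((a , b) ∷ es)) u v
  to (inj₁ p)              = w⁺ p
  to (inj₂ (inj₁ (p , q))) = w⁺ p ◅◅ inj₁ (here refl) ◅ w⁺ q
  to (inj₂ (inj₂ (p , q))) = w⁺ p ◅◅ inj₂ (here refl) ◅ w⁺ q

  step : ∀ {x y} → Joined es x y → Split y → Split x
  step e (inj₁ p)              = inj₁ (e ◅ p)
  step e (inj₂ (inj₁ (p , q))) = inj₂ (inj₁ (e ◅ p , q))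
  step e (inj₂ (inj₂ (p , q))) = inj₂ (inj₂ (e ◅ p , q))

  viaᵃ : Split b → Split a
  viaᵃ (inj₁ p)              = inj₂ (inj₁ (ε , p))
  viaᵃ (inj₂ (inj₁ (_ , q))) = inj₂ (inj₁ (ε , q))
  viaᵃ (inj₂ (inj₂ (_ , q))) = inj₁ q

  viaᵇ : Split a → Split b
  viaᵇ (inj₁ p)              = inj₂ (inj₂ (ε , p))
  viaᵇ (inj₂ (inj₁ (_ , q))) = inj₁ q
  viaᵇ (inj₂ (inj₂ (_ , q))) = inj₂ (inj₂ (ε , q))

  from : ∀ {w} → Star (Joined ((a , b) ∷ es)) w v → Split w
  from ε                      = inj₁ ε
  from (inj₁ (here refl) ◅ p) = viaᵃ (from p)
  from (inj₂ (here refl) ◅ p) = viaᵇ (from p)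
  from (inj₁ (there e)   ◅ p) = step (inj₁ e) (from p)
  from (inj₂ (there e)   ◅ p) = step (inj₂ e) (from p)

covered? : ∀ {n} (es : List (Edge n)) u → Dec (Covered es u)
covered? es u = any? (λ (i , j) → (u ≟ i) ⊎-dec (u ≟ j)) es

formConnected? : ∀ {n} (es : List (Edge n)) → Dec (FormConnected es)
formConnected? es = all? λ u → all? λ v →
  covered? es u →-dec covered? es v →-dec reachable? es u v

prefixesConnected? : ∀ {n} (σ : List (Edge n)) → Dec (PrefixesConnected σ)
prefixesConnected? σ = all? λ k → formConnected? (take (suc (toℕ k)) σ)

insertions : ∀ {A : Set} → A → List A → List (List A)
insertions x []       = [ [ x ] ]
insertions x (y ∷ ys) = (x ∷ y ∷ ys) ∷ map (y ∷_) (insertions x ys)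

permutations : ∀ {A : Set} → List A → List (List A)
permutations []       = [ [] ]
permutations (x ∷ xs) = concatMap (insertions x) (permutations xs)

shellings : ∀ {n} → Graph n → List (List (Edge n))
shellings G = filter prefixesConnected? (permutations (edges G))

F : ∀ {n} → Graph n → ℕ
F G = length (shellings G)

-- Every shelling is listed exactly once in shellings, so F counts them.

private
  module _ {A : Set} where

    insertions-sound : ∀ {x : A} ys {zs} → zs ∈ insertions x ys → zs ↭ x ∷ ys
    insertions-sound []       (here refl) = ↭-refl
    insertions-sound (y ∷ ys) (here refl) = ↭-refl
    insertions-sound (y ∷ ys) (there p) with ∈-map⁻ (y ∷_) p
    ... | _ , q , refl = ↭-trans (prep y (insertions-sound ys q)) (swap y _ ↭-refl)

    insertions-complete : ∀ {x : A} as {bs} → as ++ x ∷ bs ∈ insertions x (as ++ bs)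
    insertions-complete []       {[]}    = here refl
    insertions-complete []       {_ ∷ _} = here refl
    insertions-complete (a ∷ as)         = there (∈-map⁺ (a ∷_) (insertions-complete as))

    insertions-unique : ∀ {x : A} {ys} → x ∉ ys → Unique (insertions x ys)
    insertions-unique {ys = []}         x∉ = All.[] ∷ []
    insertions-unique {x} {ys = y ∷ ys} x∉ =
      All.tabulate fresh ∷ Unique.map⁺ (λ { refl → refl }) (insertions-unique (x∉ ∘ there))
      where
      fresh : ∀ {zs} → zs ∈ map (y ∷_) (insertions x ys) → (x ∷ y ∷ ys) ≢ zs
      fresh p refl with ∈-map⁻ (y ∷_) p
      ... | _ , _ , refl = x∉ (here refl)

    insertions-injective : ∀ {x : A} {ys ys′ zs} → x ∉ ys → x ∉ ys′ →
                           zs ∈ insertions x ys → zs ∈ insertions x ys′ → ys ≡ ys′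
    insertions-injective {ys = []}    {[]}      _  _   _           _           = refl
    insertions-injective {ys = []}    {y′ ∷ _}  _  x∉′ (here refl) (there q) with ∈-map⁻ (y′ ∷_) q
    ... | _ , _ , refl = contradiction (here refl) x∉′
    insertions-injective {ys = y ∷ _} {[]}      x∉ _   (there p)   (here refl) with ∈-map⁻ (y ∷_) p
    ... | _ , _ , refl = contradiction (here refl) x∉
    insertions-injective {ys = y ∷ _} {_ ∷ _}   _  _   (here refl) (here refl) = refl
    insertions-injective {ys = y ∷ _} {y′ ∷ _}  _  x∉′ (here refl) (there q) with ∈-map⁻ (y′ ∷_) q
    ... | _ , _ , refl = contradiction (here refl) x∉′
    insertions-injective {ys = y ∷ _} {y′ ∷ _}  x∉ _   (there p)   (here refl) with ∈-map⁻ (y ∷_) p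
    ... | _ , _ , refl = contradiction (here refl) x∉
    insertions-injective {ys = y ∷ _} {y′ ∷ _}  x∉ x∉′ (there p)   (there q)
      with ∈-map⁻ (y ∷_) p | ∈-map⁻ (y′ ∷_) q
    ... | _ , p′ , refl | _ , q′ , refl =
      cong (y ∷_) (insertions-injective (x∉ ∘ there) (x∉′ ∘ there) p′ q′)

    concat-insertions-unique : ∀ {x : A} {yss} → All (x ∉_) yss → Unique yss →
                               Unique (concatMap (insertions x) yss)
    concat-insertions-unique All.[]        []         = []
    concat-insertions-unique {x} (x∉ All.∷ x∉s) (ys∉ ∷ uq) =
      Unique.++⁺ (insertions-unique x∉) (concat-insertions-unique x∉s uq) λ (p , q) →
        let _ , ys′∈ , q′ = find (∈-concatMap⁻ (insertions x) q)
        in All.lookup ys∉ ys′∈ (insertions-injective x∉ (All.lookup x∉s ys′∈) p q′)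

permutations-sound : ∀ {A : Set} (xs : List A) {σ} → σ ∈ permutations xs → σ ↭ xs
permutations-sound []       (here refl) = ↭-refl
permutations-sound (x ∷ xs) p =
  let τ , τ∈ , q = find (∈-concatMap⁻ (insertions x) {permutations xs} p)
  in ↭-trans (insertions-sound τ q) (prep x (permutations-sound xs τ∈))

permutations-complete : ∀ {A : Set} (xs : List A) {σ} → σ ↭ xs → σ ∈ permutations xs
permutations-complete []       p with ↭-empty-inv p
... | refl = here refl
permutations-complete (x ∷ xs) p with ∈-∃++ (∈-resp-↭ (↭-sym p) (here refl))
... | as , _ , refl = ∈-concatMap⁺ (insertions x)
  (lose (permutations-complete xs (drop-mid as [] p)) (insertions-complete as))

permutations-unique : ∀ {A : Set} {xs : List A} → Unique xs → Unique (permutations xs)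
permutations-unique []                    = All.[] ∷ []
permutations-unique {xs = x ∷ xs} (x≢ ∷ uq) = concat-insertions-unique
  (All.tabulate λ τ∈ x∈τ →
    Unique[x∷xs]⇒x∉xs (x≢ ∷ uq) (∈-resp-↭ (permutations-sound xs τ∈) x∈τ))
  (permutations-unique uq)

edges-unique : ∀ {n} (G : Graph n) → Unique (edges G)
edges-unique {n} G = Unique.filter⁺ (λ (i , j) → (i <? j) ×-dec adj? G i j)
  (Unique.cartesianProduct⁺ (Unique.allFin⁺ n) (Unique.allFin⁺ n))

∈-shellings : ∀ {n} (G : Graph n) {σ} → σ ∈ shellings G ⇔ IsShelling G σ
∈-shellings G = mk⇔
  (λ p → let q , c = ∈-filter⁻ prefixesConnected? {xs = permutations (edges G)} p
         in permutations-sound (edges G) q , c)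
  (λ (p , c) → ∈-filter⁺ prefixesConnected? (permutations-complete (edges G) p) c)

shellings-unique : ∀ {n} (G : Graph n) → Unique (shellings G)
shellings-unique G = Unique.filter⁺ prefixesConnected? (permutations-unique (edges-unique G))

{-# OPTIONS --safe #-}
module Submission where

-- The last edge of a shelling of a tree with at least two edges is pendant, so
-- F(T) = Σ F(T - ℓ) over the leaves ℓ.  If p is the neighbour of ℓ, removing ℓ divides
-- P(T) = ∏ d(v)! by d(p), so by induction F(T) ≥ P(T) Σ 1/d(p(ℓ)).  In a star all
-- terms are 1/(n-1) and the sum is 1.  Any other tree has two vertices a ≠ b with all but
-- one neighbour a leaf, and these leaves contribute (d(a)-1)/d(a) + (d(b)-1)/d(b) ≥ 1.  If
-- equality holds then d(a) = d(b) = 2 and there are no further leaves, so that T has only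
-- two leaves and is a path.  Conversely, stars and trees with two leaves are closed
-- under the removal of a leaf, and for them the sum is at most 1.

open import Defs
open import Data.Bool using (if_then_else_)
open import Data.Empty using (⊥)
open import Data.Fin as Fin using (Fin; toℕ; fromℕ; fromℕ<; inject₁)
open import Data.Fin.Permutation as Permutation using (_⟨$⟩ʳ_; _⟨$⟩ˡ_; permutation; transpose)
import Data.Fin.Properties as Fin
open import Data.Fin.Properties using (_≟_)
open import Data.List using (List; []; _∷_; _∷ʳ_; _++_; [_]; length; map; filter; concatMap; take; drop; allFin; cartesianProduct; initLast; _∷ʳ′_)
import Data.List.Properties as List
open import Data.List.Membership.Propositional using (_∈_; find; lose)
open import Data.List.Membership.Propositional.Properties using (∈-map⁺; ∈-map⁻; ∈-filter⁺; ∈-filter⁻; ∈-concatMap⁺; ∈-concatMap⁻; ∈-∃++; ∈-cartesianProduct⁺; ∈-allFin; ∈-++⁺ˡ; ∈-++⁺ʳ; ∈-++⁻)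
open import Data.List.Membership.Propositional.Properties.WithK using (unique∧set⇒bag)
open import Data.List.Relation.Binary.BagAndSetEquality using (∼bag⇒↭)
open import Data.List.Relation.Binary.Permutation.Propositional using (_↭_; ↭-refl; ↭-sym; ↭-trans; ↭-reflexive; ↭⇒↭ₛ; prep; swap)
import Data.List.Relation.Binary.Permutation.Propositional.Properties as Perm
import Data.List.Relation.Binary.Permutation.Setoid.Properties as PermSetoid
open import Data.List.Relation.Unary.All as All using (All)
import Data.List.Relation.Unary.All.Properties as All
open import Data.List.Relation.Unary.AllPairs using ([]; _∷_)
open import Data.List.Relation.Unary.Any using (here; there)
open import Data.List.Relation.Unary.Linked using (Linked; [-]; _∷_)
open import Data.List.Relation.Unary.Unique.Propositional using (Unique)
open import Data.List.Relation.Unary.Unique.Propositional.Properties as Unique using (Unique[x∷xs]⇒x∉xs)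
open import Data.Nat using (ℕ; zero; suc; _+_; _*_; _∸_; _≤_; _<_; _≥_; _!; z≤n; s≤s; s≤s⁻¹; >-nonZero; >-nonZero⁻¹)
open import Data.Nat.ListAction using (sum; product)
open import Data.Nat.ListAction.Properties using (sum-↭; product≢0)
import Data.Nat.Properties as ℕ
open import Data.Nat.Solver using (module +-*-Solver)
open import Data.Product using (∃; ∃₂; _×_; _,_; proj₁; proj₂)
import Data.Product.Properties as Product
open import Data.Sum as Sum using (_⊎_; inj₁; inj₂)
open import Function using (_∘_; _⇔_; mk⇔; Equivalence)
open import Level using (0ℓ)
open import Relation.Binary using (Rel; tri<; tri≈; tri>)
open import Relation.Binary.Construct.Closure.ReflexiveTransitive as Star using (Star; ε; _◅_; _◅◅_)
open import Relation.Binary.Definitions using (DecidableEquality)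
open import Relation.Binary.PropositionalEquality using (_≡_; _≢_; refl; sym; trans; cong; cong₂; subst; subst₂; ≢-sym; setoid)
open import Relation.Nullary using (Dec; ¬_; yes; no; does; contradiction)
open import Relation.Nullary.Decidable using (_×-dec_; _⊎-dec_; ¬?; dec-true; decidable-stable)
open import Relation.Unary using (Decidable)

-- Counting shellings by their last edge

-- Deleting a leaf would shrink the vertex set, so the induction runs over edge lists on the fixed
-- set `Fin n`: a vertex that has lost its last edge gets degree 0 and contributes 0! = 1. `Tree`
-- describes these lists by growth from one edge through pendant edges; connectedness and acyclicity
-- of a graph serve only to produce such a growth of its edge list. Fractions are avoided by
-- multiplying the recursion by d(c) for a star with centre c, by d(a) d(b) for two near-leaves, and
-- by 2 for a tree with two leaves. Equality is settled by combining two dichotomies, each proved by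
-- induction on growth: star or two near-leaves, path or three leaves. Two near-leaves together with
-- three leaves make the bound strict. The margin behind this is (d(a)-1)/d(a) + (d(b)-1)/d(b) - 1 =
-- ((d(a)-1)(d(b)-1) - 1) / (d(a) d(b)), which vanishes for d(a), d(b) ≥ 2 only if both are 2; a
-- third leaf either raises one of these degrees or adds a positive term of its own.

module _ {A : Set} where

  Unique-resp-↭ : ∀ {xs ys : List A} → xs ↭ ys → Unique xs → Unique ys
  Unique-resp-↭ p = PermSetoid.Unique-resp-↭ (setoid A) (↭⇒↭ₛ p)

  unique∧sameMembers⇒↭ : ∀ {xs ys : List A} → Unique xs → Unique ys →
    (∀ {x} → x ∈ xs → x ∈ ys) → (∀ {x} → x ∈ ys → x ∈ xs) → xs ↭ ys
  unique∧sameMembers⇒↭ uxs uys f g = ∼bag⇒↭ (unique∧set⇒bag uxs uys (mk⇔ f g))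

  -- The possible last edges, each with the edges before it. Entries are chosen by position, so a
  -- sum over `picks xs` that depends on the chosen entry alone is a sum over `xs`.
  picks : List A → List (A × List A)
  picks []       = []
  picks (x ∷ xs) = (x , xs) ∷ map (λ (y , ys) → y , x ∷ ys) (picks xs)

  picks-↭ : ∀ {e r} (xs : List A) → (e , r) ∈ picks xs → xs ↭ e ∷ r
  picks-↭ (x ∷ xs) (here refl) = ↭-refl
  picks-↭ (x ∷ xs) (there p) with ∈-map⁻ _ p
  ... | (y , ys) , q , refl = ↭-trans (prep x (picks-↭ xs q)) (swap x y ↭-refl)

  map-proj₁-picks : ∀ (xs : List A) → map proj₁ (picks xs) ≡ xs
  map-proj₁-picks []       = refl
  map-proj₁-picks (x ∷ xs) = cong (x ∷_)
    (trans (sym (List.map-∘ (picks xs))) (map-proj₁-picks xs))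

  ∈-picks : ∀ {e} {xs : List A} → e ∈ xs → ∃ λ r → (e , r) ∈ picks xs
  ∈-picks {xs = xs} e∈ with ∈-map⁻ proj₁ (subst (_ ∈_) (sym (map-proj₁-picks xs)) e∈)
  ... | (_ , r) , p , refl = r , p

  -- A common element of two blocks forces equal keys, and the keys are distinct. The key will be
  -- the last edge of a shelling.
  concatMap-unique : ∀ {B K : Set} (key : B → K) (f : B → List A) {bs} →
    (∀ b → b ∈ bs → Unique (f b)) →
    (∀ b c {z} → z ∈ f b → z ∈ f c → key b ≡ key c) →
    Unique (map key bs) → Unique (concatMap f bs)
  concatMap-unique key f {[]}     uf inj []        = []
  concatMap-unique key f {b ∷ bs} uf inj (k∉ ∷ uk) =
    Unique.++⁺ (uf b (here refl)) (concatMap-unique key f (λ c → uf c ∘ there) inj uk) disjoint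
    where
    disjoint : ∀ {z} → ¬ (z ∈ f b × z ∈ concatMap f bs)
    disjoint (p , q) = let c , c∈ , q′ = find (∈-concatMap⁻ f {bs} q)
                       in All.lookup k∉ (∈-map⁺ key c∈) (inj b c p q′)

  length-concatMap : ∀ {B : Set} (f : B → List A) bs →
    length (concatMap f bs) ≡ sum (map (length ∘ f) bs)
  length-concatMap f []       = refl
  length-concatMap f (b ∷ bs) =
    trans (List.length-++ (f b)) (cong (length (f b) +_) (length-concatMap f bs))

  take-length-++ : ∀ (xs ys : List A) → take (length xs) (xs ++ ys) ≡ xs
  take-length-++ []       ys = refl
  take-length-++ (x ∷ xs) ys = cong (x ∷_) (take-length-++ xs ys)

module _ {n : ℕ} where

  Joined-resp-↭ : ∀ {es fs : List (Edge n)} {u v} → es ↭ fs → Joined es u v → Joined fs u v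
  Joined-resp-↭ p = Sum.map (Perm.∈-resp-↭ p) (Perm.∈-resp-↭ p)

  FormConnected-resp-↭ : ∀ {es fs : List (Edge n)} → es ↭ fs → FormConnected es → FormConnected fs
  FormConnected-resp-↭ p c u v cu cv = Star.map (Joined-resp-↭ p)
    (c u v (Perm.Any-resp-↭ (↭-sym p) cu) (Perm.Any-resp-↭ (↭-sym p) cv))

  -- Splittings instead of indices, so that appending and dropping a last edge become list algebra.
  -- The empty prefix is included; it is connected vacuously.
  AllPrefixesConnected : List (Edge n) → Set
  AllPrefixesConnected σ = ∀ ρ τ → σ ≡ ρ ++ τ → FormConnected ρ

  prefixes⇒allPrefixes : ∀ σ → PrefixesConnected σ → AllPrefixesConnected σ
  prefixes⇒allPrefixes σ c []      τ eq   = λ _ _ ()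
  prefixes⇒allPrefixes σ c (e ∷ ρ) τ refl =
    subst FormConnected
      (trans (cong (λ k → take (suc k) σ) (Fin.toℕ-fromℕ< l<)) (take-length-++ (e ∷ ρ) τ))
      (c (fromℕ< l<))
    where l< = s≤s (List.length-++-≤ˡ ρ {τ})

  allPrefixes⇒prefixes : ∀ σ → AllPrefixesConnected σ → PrefixesConnected σ
  allPrefixes⇒prefixes σ c k =
    c (take (suc (toℕ k)) σ) (drop (suc (toℕ k)) σ) (sym (List.take++drop≡id (suc (toℕ k)) σ))

  allPrefixes-∷ʳ : ∀ {τ e} → AllPrefixesConnected τ → FormConnected (τ ∷ʳ e) →
                   AllPrefixesConnected (τ ∷ʳ e)
  allPrefixes-∷ʳ {τ} {e} c ce ρ ω eq with initLast ω
  ... | []       = subst FormConnected (trans eq (List.++-identityʳ ρ)) ce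
  ... | ω′ ∷ʳ′ x = c ρ ω′ (List.∷ʳ-injectiveˡ τ (ρ ++ ω′) (trans eq (sym (List.++-assoc ρ ω′ [ x ]))))

  allPrefixes-init : ∀ {τ e} → AllPrefixesConnected (τ ∷ʳ e) → AllPrefixesConnected τ
  allPrefixes-init {τ} {e} c ρ ω eq =
    c ρ (ω ∷ʳ e) (trans (cong (_∷ʳ e) eq) (List.++-assoc ρ ω [ e ]))

  shells : List (Edge n) → List (List (Edge n))
  shells es = filter prefixesConnected? (permutations es)

  opaque
    count : List (Edge n) → ℕ
    count es = length (shells es)

    F≡count : ∀ (G : Graph n) → F G ≡ count (edges G)
    F≡count G = refl

    count-[] : count [] ≡ 1
    count-[] = refl

    count≡0 : ∀ es → (∀ {σ} → ¬ σ ∈ shells es) → count es ≡ 0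
    count≡0 es none with shells es
    ... | []    = refl
    ... | σ ∷ _ = contradiction (here refl) none

  ∈-shells⁺ : ∀ {es σ} → σ ↭ es → AllPrefixesConnected σ → σ ∈ shells es
  ∈-shells⁺ {es} {σ} p c =
    ∈-filter⁺ prefixesConnected? (permutations-complete es p) (allPrefixes⇒prefixes σ c)

  ∈-shells⁻ : ∀ {es σ} → σ ∈ shells es → σ ↭ es × AllPrefixesConnected σ
  ∈-shells⁻ {es} {σ} σ∈ =
    let p , c = ∈-filter⁻ prefixesConnected? {xs = permutations es} σ∈
    in permutations-sound es p , prefixes⇒allPrefixes σ c

  shells-unique : ∀ {es} → Unique es → Unique (shells es)
  shells-unique u = Unique.filter⁺ prefixesConnected? (permutations-unique u)

  -- A shelling is a prefix of itself. This removes the non-pendant edges of a tree from the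
  -- last-edge recursion.
  count-disconnected : ∀ es → ¬ FormConnected es → count es ≡ 0
  count-disconnected es ¬c = count≡0 es λ {σ} σ∈ → let p , c = ∈-shells⁻ σ∈ in
    ¬c (FormConnected-resp-↭ p (c σ [] (sym (List.++-identityʳ σ))))

  lastEdge : Edge n × List (Edge n) → List (List (Edge n))
  lastEdge (e , r) = map (_∷ʳ e) (shells r)

  -- Appending the last edge adds a single new prefix, the whole list, and that one is connected by
  -- assumption. Hence the earlier edges may be any shelling of the rest.
  shells-lastEdge : ∀ {es} → Unique es → es ≢ [] → FormConnected es →
                    shells es ↭ concatMap lastEdge (picks es)
  shells-lastEdge {es} u ≢[] c = unique∧sameMembers⇒↭ (shells-unique u)
    (concatMap-unique proj₁ lastEdge uniqueEach sameLast
      (subst Unique (sym (map-proj₁-picks es)) u))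
    to from
    where
    uniqueEach : ∀ b → b ∈ picks es → Unique (lastEdge b)
    uniqueEach (e , r) b∈ with Unique-resp-↭ (picks-↭ es b∈) u
    ... | _ ∷ ur = Unique.map⁺ (List.∷ʳ-injectiveˡ _ _) (shells-unique ur)

    sameLast : ∀ b c {z} → z ∈ lastEdge b → z ∈ lastEdge c → proj₁ b ≡ proj₁ c
    sameLast _ _ p q with ∈-map⁻ _ p | ∈-map⁻ _ q
    ... | σ , _ , refl | τ , _ , eq = List.∷ʳ-injectiveʳ σ τ eq

    to : ∀ {σ} → σ ∈ shells es → σ ∈ concatMap lastEdge (picks es)
    to {σ} σ∈ with initLast σ | ∈-shells⁻ σ∈
    ... | []      | p , _ = contradiction (Perm.↭-empty-inv (↭-sym p)) ≢[]
    ... | τ ∷ʳ′ e | p , cσ =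
      let r , r∈ = ∈-picks (Perm.∈-resp-↭ (↭-trans (Perm.∷↭∷ʳ e τ) p) (here refl))
          τ↭r = Perm.drop-∷ (↭-trans (Perm.∷↭∷ʳ e τ) (↭-trans p (picks-↭ es r∈)))
      in ∈-concatMap⁺ lastEdge
           (lose r∈ (∈-map⁺ (_∷ʳ e) (∈-shells⁺ τ↭r (allPrefixes-init cσ))))

    from : ∀ {σ} → σ ∈ concatMap lastEdge (picks es) → σ ∈ shells es
    from σ∈ with find (∈-concatMap⁻ lastEdge {picks es} σ∈)
    ... | (e , r) , r∈ , q with ∈-map⁻ _ q
    ...   | τ , τ∈ , refl =
      let p , cτ = ∈-shells⁻ τ∈
          σ↭es = ↭-trans (↭-sym (Perm.∷↭∷ʳ e τ)) (↭-trans (prep e p) (↭-sym (picks-↭ es r∈)))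
      in ∈-shells⁺ σ↭es (allPrefixes-∷ʳ cτ (FormConnected-resp-↭ (↭-sym σ↭es) c))

  opaque
    unfolding count

    count-lastEdge : ∀ {es} → Unique es → es ≢ [] → FormConnected es →
                     count es ≡ sum (map (count ∘ proj₂) (picks es))
    count-lastEdge {es} u ≢[] c = trans (Perm.↭-length (shells-lastEdge u ≢[] c))
      (trans (length-concatMap lastEdge (picks es))
        (cong sum (List.map-cong (λ (e , r) → List.length-map (_∷ʳ e) (shells r)) (picks es))))

-- Edge lists of trees

-- Lets two removals from one list be commuted, which is needed when the edge to be removed is not
-- the one grown last.
∷↭∷-cases : ∀ {A : Set} {x y : A} {xs ys} → x ∷ xs ↭ y ∷ ys →
  (x ≡ y × xs ↭ ys) ⊎ ∃ λ zs → xs ↭ y ∷ zs × ys ↭ x ∷ zs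
∷↭∷-cases {x = x} {y} {xs} {ys} p with Perm.∈-resp-↭ p (here refl)
... | here refl = inj₁ (refl , Perm.drop-∷ p)
... | there x∈ with ∈-∃++ x∈
...   | as , bs , refl = inj₂ (as ++ bs , Perm.drop-∷ q , Perm.shift x as bs)
  where
  q : x ∷ xs ↭ x ∷ y ∷ as ++ bs
  q = ↭-trans p (↭-trans (prep y (Perm.shift x as bs)) (swap y x ↭-refl))

module _ {n : ℕ} where

  Incident : Fin n → Edge n → Set
  Incident v e = v ≡ proj₁ e ⊎ v ≡ proj₂ e

  incident? : ∀ v e → Dec (Incident v e)
  incident? v e = (v ≟ proj₁ e) ⊎-dec (v ≟ proj₂ e)

  Ends : Edge n → Fin n → Fin n → Set
  Ends e p q = e ≡ (p , q) ⊎ e ≡ (q , p)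

  endsˡ : ∀ {e p q} → Ends e p q → Incident p e
  endsˡ (inj₁ refl) = inj₁ refl
  endsˡ (inj₂ refl) = inj₂ refl

  endsʳ : ∀ {e p q} → Ends e p q → Incident q e
  endsʳ = endsˡ ∘ Sum.swap

  incident-ends : ∀ {e p q v} → Ends e p q → Incident v e → v ≡ p ⊎ v ≡ q
  incident-ends (inj₁ refl) i = i
  incident-ends (inj₂ refl) i = Sum.swap i

  otherEnd : ∀ {e v} → Incident v e → ∃ (Ends e v)
  otherEnd (inj₁ refl) = _ , inj₁ refl
  otherEnd (inj₂ refl) = _ , inj₂ refl

  ends-unique : ∀ {e v p q} → Ends e v p → Ends e v q → p ≡ q
  ends-unique (inj₁ refl) (inj₁ refl) = refl
  ends-unique (inj₁ refl) (inj₂ refl) = refl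
  ends-unique (inj₂ refl) (inj₁ refl) = refl
  ends-unique (inj₂ refl) (inj₂ refl) = refl

  covered⁻ : ∀ {es : List (Edge n)} {v} → Covered es v → ∃ λ e → e ∈ es × Incident v e
  covered⁻ = find

  covered⁺ : ∀ {es : List (Edge n)} {v e} → e ∈ es → Incident v e → Covered es v
  covered⁺ = lose

  covered-resp-↭ : ∀ {es fs : List (Edge n)} {v} → es ↭ fs → Covered es v → Covered fs v
  covered-resp-↭ = Perm.Any-resp-↭

  joined-covered : ∀ {es : List (Edge n)} {u v} → Joined es u v → Covered es u
  joined-covered (inj₁ m) = covered⁺ m (inj₁ refl)
  joined-covered (inj₂ m) = covered⁺ m (inj₂ refl)

  reachable-covered : ∀ {es : List (Edge n)} {u v} → Star (Joined es) u v → Covered es u → Covered es v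
  reachable-covered ε       c = c
  reachable-covered (j ◅ p) c = reachable-covered p (joined-covered (Sum.swap j))

  nonempty-covered : ∀ {es : List (Edge n)} → es ≢ [] → ∃ (Covered es)
  nonempty-covered {[]}    ≢[] = contradiction refl ≢[]
  nonempty-covered {e ∷ _} _   = proj₁ e , here (inj₁ refl)

  record Grows (r : List (Edge n)) (e : Edge n) : Set where
    constructor grows
    field
      {foot tip} : Fin n
      ends       : Ends e foot tip
      footOld    : Covered r foot
      tipNew     : ¬ Covered r tip

  grows-resp-↭ : ∀ {r s e} → r ↭ s → Grows r e → Grows s e
  grows-resp-↭ p (grows ends old new) =
    grows ends (covered-resp-↭ p old) (new ∘ covered-resp-↭ (↭-sym p))

  -- Growth starts from one edge, because an empty list covers no vertex that could serve as a foot.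
  -- The permutation in `grow` separates the order of growth from the order of the list.
  data Tree : List (Edge n) → Set where
    single : ∀ {a b} → a ≢ b → Tree [ (a , b) ]
    grow   : ∀ {r e es} → Tree r → Grows r e → es ↭ e ∷ r → Tree es

  tree-resp-↭ : ∀ {es fs} → es ↭ fs → Tree es → Tree fs
  tree-resp-↭ p (single a≢b) with Perm.↭-singleton-inv (↭-sym p)
  ... | refl = single a≢b
  tree-resp-↭ p (grow t g q) = grow t g (↭-trans (↭-sym p) q)

  tree-nonempty : Tree [] → ⊥
  tree-nonempty (grow t g p) = Perm.¬x∷xs↭[] (↭-sym p)

  tree-unique : ∀ {es} → Tree es → Unique es
  tree-unique (single _) = All.[] ∷ []
  tree-unique (grow t (grows ends _ new) p) = Unique-resp-↭ (↭-sym p)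
    (All.tabulate (λ { f∈ refl → new (covered⁺ f∈ (endsʳ ends)) }) ∷ tree-unique t)

  tree-loopless : ∀ {es e a b} → Tree es → e ∈ es → Ends e a b → a ≢ b
  tree-loopless (single a≢b) (here refl) (inj₁ refl) refl = a≢b refl
  tree-loopless (single a≢b) (here refl) (inj₂ refl) refl = a≢b refl
  tree-loopless (grow t (grows ends old new) p) e∈ ends′ a≡b with Perm.∈-resp-↭ p e∈
  ... | there e∈r = tree-loopless t e∈r ends′ a≡b
  tree-loopless (grow t (grows (inj₁ refl) old new) p) e∈ (inj₁ refl) refl | here refl = new old
  tree-loopless (grow t (grows (inj₁ refl) old new) p) e∈ (inj₂ refl) refl | here refl = new old
  tree-loopless (grow t (grows (inj₂ refl) old new) p) e∈ (inj₁ refl) refl | here refl = new old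
  tree-loopless (grow t (grows (inj₂ refl) old new) p) e∈ (inj₂ refl) refl | here refl = new old

  tree-connected : ∀ {es} → Tree es → FormConnected es
  tree-connected (single {a} {b} a≢b) u v cu cv = toA cu ◅◅ Star.reverse Sum.swap (toA cv)
    where
    toA : ∀ {w} → Covered [ (a , b) ] w → Star (Joined [ (a , b) ]) w a
    toA (here (inj₁ refl)) = ε
    toA (here (inj₂ refl)) = inj₂ (here refl) ◅ ε
  tree-connected (grow {r} {e} t (grows {p} {ℓ} ends old new) q) =
    FormConnected-resp-↭ (↭-sym q) λ u v cu cv → toFoot cu ◅◅ Star.reverse Sum.swap (toFoot cv)
    where
    tip-foot : Joined (e ∷ r) ℓ p
    tip-foot = Sum.map (λ { refl → here refl }) (λ { refl → here refl }) (Sum.swap ends)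

    toFoot : ∀ {w} → Covered (e ∷ r) w → Star (Joined (e ∷ r)) w p
    toFoot (there c) = Star.map (Sum.map there there) (tree-connected t _ _ c old)
    toFoot (here i) with incident-ends ends i
    ... | inj₁ refl = ε
    ... | inj₂ refl = tip-foot ◅ ε

  -- Folding a pendant edge onto its foot is a retraction of the graph.
  module Retract {r : List (Edge n)} {e : Edge n} {p ℓ : Fin n} (ends : Ends e p ℓ) (new : ¬ Covered r ℓ) where

    retract : Fin n → Fin n
    retract x with x ≟ ℓ
    ... | yes _ = p
    ... | no  _ = x

    retract-old : ∀ {x} → x ≢ ℓ → retract x ≡ x
    retract-old {x} x≢ with x ≟ ℓ
    ... | yes x≡ = contradiction x≡ x≢
    ... | no  _  = refl

    retract-end : ∀ {x} → x ≡ p ⊎ x ≡ ℓ → retract x ≡ p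
    retract-end {x} _ with x ≟ ℓ
    retract-end _           | yes _  = refl
    retract-end (inj₁ x≡)   | no  _  = x≡
    retract-end (inj₂ x≡)   | no  x≢ = contradiction x≡ x≢

    covered-≢ : ∀ {x} → Covered r x → x ≢ ℓ
    covered-≢ c refl = new c

    step-old : ∀ {x y} → Joined r x y → Star (Joined r) (retract x) (retract y)
    step-old j rewrite retract-old (covered-≢ (joined-covered j))
                     | retract-old (covered-≢ (joined-covered (Sum.swap j))) = j ◅ ε

    step : ∀ {x y} → Joined (e ∷ r) x y → Star (Joined r) (retract x) (retract y)
    step (inj₁ (here refl)) =
      subst (Star (Joined r) _) (trans (retract-end (incident-ends ends (inj₁ refl)))
                                (sym (retract-end (incident-ends ends (inj₂ refl))))) ε
    step (inj₂ (here refl)) =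
      subst (Star (Joined r) _) (trans (retract-end (incident-ends ends (inj₂ refl)))
                                (sym (retract-end (incident-ends ends (inj₁ refl))))) ε
    step (inj₁ (there m)) = step-old (inj₁ m)
    step (inj₂ (there m)) = step-old (inj₂ m)

    retract-path : ∀ {x y} → Star (Joined (e ∷ r)) x y → Star (Joined r) (retract x) (retract y)
    retract-path = Star.kleisliStar retract step

    -- The retraction fixes every vertex covered by `r`, so a path between two of them retracts to a
    -- path in `r` with the same ends.
    connected : FormConnected (e ∷ r) → FormConnected r
    connected c u v cu cv
      with p ← retract-path (c u v (there cu) (there cv))
      rewrite retract-old (covered-≢ cu) | retract-old (covered-≢ cv) = p

    -- A path from some vertex of `r` to the foot retracts to a path inside `r` that still ends at
    -- the foot.
    foot-covered : FormConnected (e ∷ r) → r ≢ [] → Covered r p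
    foot-covered c ≢[] with nonempty-covered ≢[]
    ... | x , cx with q ← retract-path (c x p (there cx) (here (endsˡ ends)))
                 rewrite retract-old (covered-≢ cx) | retract-end {p} (inj₁ refl) = reachable-covered q cx

  -- Induction on growth. If the last grown edge `e′` differs from `e`, retracting `e′` shows that
  -- the list `s` without both edges is connected; the induction hypothesis removes `e` before `e′`
  -- was added, and then `e′` is grown on `s` and `e` after it.
  tree-remove : ∀ {es e r} → Tree es → es ↭ e ∷ r → r ≢ [] → FormConnected r → Tree r × Grows r e
  tree-remove (single _) p ≢[] c with ∷↭∷-cases p
  ... | inj₁ (_ , q)     = contradiction (Perm.↭-empty-inv (↭-sym q)) ≢[]
  ... | inj₂ (_ , q , _) = contradiction (↭-sym q) Perm.¬x∷xs↭[]
  tree-remove {es} {e} {r} (grow {r′} {e′} t g q) p ≢[] c with ∷↭∷-cases (↭-trans (↭-sym p) q)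
  ... | inj₁ (refl , s) = tree-resp-↭ (↭-sym s) t , grows-resp-↭ (↭-sym s) g
  tree-remove {es} {e} {r} (grow {r′} {e′} t (grows {p′} {ℓ′} ends old new) q) p ≢[] c
      | inj₂ (s , r↭ , r′↭) = helper s r↭ r′↭
    where
    helper : ∀ s → r ↭ e′ ∷ s → r′ ↭ e ∷ s → Tree r × Grows r e
    -- With two edges in all there is no smaller tree to fall back on: `e` is attached directly to
    -- `e′` at their common vertex `p′`.
    helper [] r↭ r′↭ with Perm.↭-singleton-inv r↭ | Perm.↭-singleton-inv r′↭
    ... | refl | refl = tree-e′ , grow-e
      where
      tree-e′ : Tree [ e′ ]
      tree-e′ = single λ { refl → new (subst (Covered _) (loop ends) old) }
        where
        loop : ∀ {a x y} → Ends (a , a) x y → x ≡ y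
        loop (inj₁ refl) = refl
        loop (inj₂ refl) = refl

      grow-e : Grows [ e′ ] e
      grow-e with covered⁻ old
      ... | _ , here refl , i with otherEnd i
      ...   | x , ends-e = grows ends-e (here (endsˡ ends)) λ { (here ix) → fresh (incident-ends ends ix) }
        where
        fresh : x ≡ p′ ⊎ x ≡ ℓ′ → ⊥
        fresh (inj₁ refl) = tree-loopless t (here refl) ends-e refl
        fresh (inj₂ refl) = new (here (endsʳ ends-e))
    helper s@(_ ∷ _) r↭ r′↭
      with tree-remove t r′↭ (λ ()) (R.connected (FormConnected-resp-↭ r↭ c))
      where module R = Retract {s} ends (λ c → new (covered-resp-↭ (↭-sym r′↭) (there c)))
    ... | tree-s , grows {x} {y} ends-e old-e new-e =
      grow tree-s (grows ends p′∈s new-s) r↭ ,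
      grows ends-e (covered-resp-↭ (↭-sym r↭) (there old-e)) (fresh ∘ covered-resp-↭ r↭)
      where
      new-s : ¬ Covered s ℓ′
      new-s c = new (covered-resp-↭ (↭-sym r′↭) (there c))

      -- The foot of `e′` might a priori be covered by `e` alone. Then `e′` would be separated from
      -- `s` in `r`, which is connected.
      p′∈s : Covered s p′
      p′∈s = Retract.foot-covered ends new-s (FormConnected-resp-↭ r↭ c) (λ ())

      fresh : ¬ Covered (e′ ∷ s) y
      fresh (there c) = new-e c
      fresh (here i) with incident-ends ends i
      ... | inj₁ refl = new-e p′∈s
      ... | inj₂ refl = new (covered-resp-↭ (↭-sym r′↭) (here (endsʳ ends-e)))

-- Degrees and near-leaves

indicator : ∀ {P : Set} → Dec P → ℕ
indicator d = if does d then 1 else 0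

indicator-yes : ∀ {P : Set} (d : Dec P) → P → indicator d ≡ 1
indicator-yes (yes _) _ = refl
indicator-yes (no ¬p) p = contradiction p ¬p

indicator-no : ∀ {P : Set} (d : Dec P) → ¬ P → indicator d ≡ 0
indicator-no (yes p) ¬p = contradiction p ¬p
indicator-no (no _)  _  = refl

module _ {A : Set} where

  ∈⇒↭ : ∀ {x} {xs : List A} → x ∈ xs → ∃ λ ys → xs ↭ x ∷ ys
  ∈⇒↭ {xs = xs} x∈ = let r , r∈ = ∈-picks x∈ in r , picks-↭ xs r∈

  product-cong : ∀ {f g : A → ℕ} xs → (∀ x → x ∈ xs → f x ≡ g x) →
                 product (map f xs) ≡ product (map g xs)
  product-cong []       eq = refl
  product-cong (x ∷ xs) eq = cong₂ _*_ (eq x (here refl)) (product-cong xs (λ y → eq y ∘ there))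

  product-scale : ∀ {f g : A → ℕ} k {p} xs → Unique xs → p ∈ xs →
    f p ≡ k * g p → (∀ x → x ≢ p → f x ≡ g x) → product (map f xs) ≡ k * product (map g xs)
  product-scale {f} {g} k {p} (p ∷ xs) (p∉ ∷ u) (here refl) at else =
    trans (cong₂ _*_ at (product-cong xs (λ x x∈ → else x (≢-sym (All.lookup p∉ x∈)))))
          (ℕ.*-assoc k (g p) _)
  product-scale {f} {g} k {p} (x ∷ xs) (x∉ ∷ u) (there p∈) at else =
    trans (cong₂ _*_ (else x (All.lookup x∉ p∈)) (product-scale k xs u p∈ at else))
    (trans (sym (ℕ.*-assoc (g x) k _))
    (trans (cong (_* product (map g xs)) (ℕ.*-comm (g x) k)) (ℕ.*-assoc k (g x) _)))

module _ {n : ℕ} where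

  opaque
    inc : Fin n → Edge n → ℕ
    inc v e = indicator (incident? v e)

    inc-yes : ∀ {v e} → Incident v e → inc v e ≡ 1
    inc-yes {v} {e} = indicator-yes (incident? v e)

    inc-no : ∀ {v e} → ¬ Incident v e → inc v e ≡ 0
    inc-no {v} {e} = indicator-no (incident? v e)

  opaque
    deg : List (Edge n) → Fin n → ℕ
    deg es v = sum (map (inc v) es)

    deg-sum : ∀ es v → deg es v ≡ sum (map (inc v) es)
    deg-sum _ _ = refl

    deg-[] : ∀ v → deg [] v ≡ 0
    deg-[] v = refl

    deg-↭ : ∀ {es fs : List (Edge n)} v → es ↭ fs → deg es v ≡ deg fs v
    deg-↭ v p = sum-↭ (Perm.map⁺ (inc v) p)

    deg-∷ : ∀ {v e} r → Incident v e → deg (e ∷ r) v ≡ suc (deg r v)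
    deg-∷ r i = cong (_+ _) (inc-yes i)

    deg-∷-other : ∀ {v e} r → ¬ Incident v e → deg (e ∷ r) v ≡ deg r v
    deg-∷-other r ¬i = cong (_+ _) (inc-no ¬i)

    deg-∷-≤ : ∀ {v e} r → deg r v ≤ deg (e ∷ r) v
    deg-∷-≤ r = ℕ.m≤n+m _ _

  deg-uncovered : ∀ {v} (es : List (Edge n)) → ¬ Covered es v → deg es v ≡ 0
  deg-uncovered []       ¬c = deg-[] _
  deg-uncovered (e ∷ es) ¬c = trans (deg-∷-other es (¬c ∘ here)) (deg-uncovered es (¬c ∘ there))

  deg-covered : ∀ {v} (es : List (Edge n)) → Covered es v → 1 ≤ deg es v
  deg-covered (e ∷ es) (here i)  = subst (1 ≤_) (sym (deg-∷ es i)) (s≤s z≤n)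
  deg-covered (e ∷ es) (there c) = ℕ.≤-trans (deg-covered es c) (deg-∷-≤ {e = e} es)

  covered-deg : ∀ {v} (es : List (Edge n)) → 1 ≤ deg es v → Covered es v
  covered-deg {v} [] d = contradiction (sym (deg-[] v)) (ℕ.<⇒≢ d)
  covered-deg {v} (e ∷ es) d with incident? v e
  ... | yes i = here i
  ... | no ¬i = there (covered-deg es (subst (1 ≤_) (deg-∷-other es ¬i) d))

  deg≡1-unique : ∀ {es v e f} → deg es v ≡ 1 → e ∈ es → Incident v e → f ∈ es → Incident v f → e ≡ f
  deg≡1-unique {es} {v} {e} {f} d e∈ ie f∈ if with ∈⇒↭ e∈
  ... | r , p with Perm.∈-resp-↭ p f∈
  ...   | here refl = refl
  ...   | there f∈r = contradiction
    (trans (sym d) (trans (deg-↭ v p) (deg-∷ r ie)))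
    (ℕ.<⇒≢ (s≤s (deg-covered r (covered⁺ f∈r if))))

  opaque
    -- The product runs over all of `Fin n`; uncovered vertices contribute 0! = 1, so lists covering
    -- different vertex sets can be compared.
    ∏deg! : List (Edge n) → ℕ
    ∏deg! es = product (map (λ v → deg es v !) (allFin n))

    ∏deg!-def : ∀ es → ∏deg! es ≡ product (map (λ v → deg es v !) (allFin n))
    ∏deg!-def es = refl

    ∏deg!>0 : ∀ es → 1 ≤ ∏deg! es
    ∏deg!>0 es = >-nonZero⁻¹ _ {{product≢0 {map (λ v → deg es v !) (allFin n)}
      (All.map⁺ (All.universal (λ v → >-nonZero (ℕ.1≤n! (deg es v))) (allFin n)))}}

    ∏deg!-↭ : ∀ {es fs : List (Edge n)} → es ↭ fs → ∏deg! es ≡ ∏deg! fs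
    ∏deg!-↭ p = product-cong (allFin n) (λ v _ → cong _! (deg-↭ v p))

  module Growth {r : List (Edge n)} {e : Edge n} (g : Grows r e) where
    open Grows g renaming (foot to p; tip to ℓ; footOld to old; tipNew to new)

    private es = e ∷ r

    old≢tip : ∀ {x} → Covered r x → x ≢ ℓ
    old≢tip c refl = new c

    deg-tip : deg es ℓ ≡ 1
    deg-tip = trans (deg-∷ r (endsʳ ends)) (cong suc (deg-uncovered r new))

    deg-foot : deg es p ≡ suc (deg r p)
    deg-foot = deg-∷ r (endsˡ ends)

    not-end : ∀ {x} → x ≢ p → x ≢ ℓ → ¬ Incident x e
    not-end x≢p x≢ℓ i with incident-ends ends i
    ... | inj₁ x≡p = x≢p x≡p
    ... | inj₂ x≡ℓ = x≢ℓ x≡ℓ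

    deg-other : ∀ {x} → x ≢ p → x ≢ ℓ → deg es x ≡ deg r x
    deg-other x≢p x≢ℓ = deg-∷-other r (not-end x≢p x≢ℓ)

    deg-old : ∀ {x} → Covered r x → x ≢ p → deg es x ≡ deg r x
    deg-old c x≢p = deg-other x≢p (old≢tip c)

    opaque
      unfolding ∏deg!

      -- The tip passes from 0! to 1!, both equal to 1, so only the factor at the foot changes.
      ∏deg!-grow : ∏deg! es ≡ deg es p * ∏deg! r
      ∏deg!-grow = product-scale (deg es p) (allFin n) (Unique.allFin⁺ n) (∈-allFin p)
        (trans (cong _! deg-foot) (cong (_* (deg r p !)) (sym deg-foot))) elsewhere
        where
        elsewhere : ∀ x → x ≢ p → deg es x ! ≡ deg r x !
        elsewhere x x≢p with x ≟ ℓ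
        ... | yes refl = trans (cong _! deg-tip) (sym (cong _! (deg-uncovered r new)))
        ... | no x≢ℓ   = cong _! (deg-other x≢p x≢ℓ)

  -- Stars, near-leaves and the effect of growth on them.

  LeafEdge : List (Edge n) → Fin n → Edge n → Set
  LeafEdge es a e = ∃ λ ℓ → Ends e a ℓ × deg es ℓ ≡ 1

  StarAt : List (Edge n) → Fin n → Set
  StarAt es c = ∀ {e} → e ∈ es → LeafEdge es c e

  -- `h` is the edge at `a` that may lead to a non-leaf; at least deg - 1 edges at `a` are then leaf
  -- edges. The bound 2 ≤ deg keeps `a` from being a leaf, which makes the leaf edges of two
  -- near-leaves disjoint.
  NearLeaf : List (Edge n) → Fin n → Edge n → Set
  NearLeaf es a h = 2 ≤ deg es a × (∀ {e} → e ∈ es → Incident a e → e ≢ h → LeafEdge es a e)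

  TwoNearLeaves : List (Edge n) → Set
  TwoNearLeaves es = ∃₂ λ a b → a ≢ b × ∃ (NearLeaf es a) × ∃ (NearLeaf es b)

  leafEdge-↭ : ∀ {es fs a e} → es ↭ fs → LeafEdge es a e → LeafEdge fs a e
  leafEdge-↭ p (ℓ , ends , d) = ℓ , ends , trans (sym (deg-↭ ℓ p)) d

  starAt-↭ : ∀ {es fs c} → es ↭ fs → StarAt es c → StarAt fs c
  starAt-↭ p s e∈ = leafEdge-↭ p (s (Perm.∈-resp-↭ (↭-sym p) e∈))

  nearLeaf-↭ : ∀ {es fs a h} → es ↭ fs → NearLeaf es a h → NearLeaf fs a h
  nearLeaf-↭ {a = a} p (d , f) = subst (2 ≤_) (deg-↭ a p) d ,
    λ e∈ i ≢h → leafEdge-↭ p (f (Perm.∈-resp-↭ (↭-sym p) e∈) i ≢h)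

  twoNearLeaves-↭ : ∀ {es fs} → es ↭ fs → TwoNearLeaves es → TwoNearLeaves fs
  twoNearLeaves-↭ p (a , b , a≢b , (h , nh) , (k , nk)) =
    a , b , a≢b , (h , nearLeaf-↭ p nh) , (k , nearLeaf-↭ p nk)

  module GrowNearLeaf {r : List (Edge n)} {e : Edge n} (g : Grows r e) where
    open Grows g renaming (foot to p; tip to ℓ; footOld to old; tipNew to new)
    open Growth g
    private es = e ∷ r

    -- Among the old vertices only `p` gains degree, so only a leaf edge whose leaf is `p` can be
    -- spoiled; `ok` rules that out.
    keepLeafEdge : ∀ {a f} → f ∈ r → (Ends f a p → deg r p ≢ 1) → LeafEdge r a f → LeafEdge es a f
    keepLeafEdge f∈ ok (x , ends-f , d) = x , ends-f , trans (deg-old (covered⁺ f∈ (endsʳ ends-f)) x≢p) d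
      where
      x≢p : x ≢ p
      x≢p refl = ok ends-f d

    keepNearLeaf : ∀ {a h} → NearLeaf r a h →
      (∀ {f} → f ∈ r → f ≢ h → Ends f a p → deg r p ≢ 1) → NearLeaf es a h
    keepNearLeaf {a} {h} (d , lf) ok = ℕ.≤-trans d (deg-∷-≤ {e = e} r) , leaf
      where
      leaf : ∀ {f} → f ∈ es → Incident a f → f ≢ h → LeafEdge es a f
      leaf (here refl) i f≢h with incident-ends ends i
      ... | inj₁ refl = ℓ , ends , deg-tip
      ... | inj₂ refl = contradiction (covered-deg r (ℕ.≤-trans (s≤s z≤n) d)) new
      leaf (there f∈) i f≢h = keepLeafEdge f∈ (ok f∈ f≢h) (lf f∈ i f≢h)

    -- A former leaf now has two edges: its old edge, which is the exception, and the new one, which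
    -- leads to the tip.
    footNearLeaf : ∀ {f} → deg r p ≡ 1 → f ∈ r → Incident p f → NearLeaf es p f
    footNearLeaf {f} d f∈ i = subst (2 ≤_) (sym (trans deg-foot (cong suc d))) ℕ.≤-refl , leaf
      where
      leaf : ∀ {f′} → f′ ∈ es → Incident p f′ → f′ ≢ f → LeafEdge es p f′
      leaf (here refl) _  _    = ℓ , ends , deg-tip
      leaf (there f′∈) i′ f′≢f = contradiction (deg≡1-unique d f′∈ i′ f∈ i) f′≢f

    extendStar : ∀ {c} → Tree r → StarAt r c → ∃ (StarAt es) ⊎ TwoNearLeaves es
    extendStar {c} t s with c ≟ p
    ... | yes refl = inj₁ (p , λ { (here refl) → ℓ , ends , deg-tip
                                 ; (there f∈)  → keepLeafEdge f∈ (λ ends-f → contradiction refl (tree-loopless t f∈ ends-f)) (s f∈) })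
    ... | no c≢p with covered⁻ old
    ...   | f , f∈ , i with s f∈
    ...     | x , ends-f , d with incident-ends ends-f i
    ...       | inj₁ refl = contradiction refl c≢p
    ...       | inj₂ refl with deg r c ℕ.≟ 1
    -- The old star is a single edge; together with the new edge it is a star with centre `p`.
    ...         | yes d₁ = inj₁ (p , λ where
      (here refl) → ℓ , ends , deg-tip
      (there f′∈) → let x′ , ends-f′ , _ = s f′∈ in
        c , subst (λ f → Ends f p c) (deg≡1-unique d₁ f∈ (endsˡ ends-f) f′∈ (endsˡ ends-f′)) (Sum.swap ends-f)
          , trans (deg-old (covered⁺ f∈ (endsˡ ends-f)) c≢p) d₁)
    -- A leaf of a larger star has grown an edge. The edge `f` between `c` and `p` is the exception
    -- for both near-leaves.
    ...         | no d≢1 = inj₂ (p , c , ≢-sym c≢p , (f , footNearLeaf d f∈ i) ,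
      (f , keepNearLeaf (deg≥2 , λ f′∈ _ _ → s f′∈)
             (λ f′∈ f′≢f ends-f′ _ → f′≢f (deg≡1-unique d f′∈ (endsʳ ends-f′) f∈ i))))
      where
      deg≥2 : 2 ≤ deg r c
      deg≥2 = ℕ.≤∧≢⇒< (deg-covered r (covered⁺ f∈ (endsˡ ends-f))) (≢-sym d≢1)

    -- Nothing is lost unless `p` was a leaf. In that case only its neighbour `u` can lose the
    -- property, while `p` gains it; so `p` is paired with one of `a`, `b` that differs from `u`.
    extendNearLeaves : TwoNearLeaves r → TwoNearLeaves es
    extendNearLeaves (a , b , a≢b , (h , nh) , (k , nk)) with deg r p ℕ.≟ 1
    ... | no d≢1 = a , b , a≢b , (h , keepNearLeaf nh λ _ _ _ → d≢1) , (k , keepNearLeaf nk λ _ _ _ → d≢1)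
    ... | yes d with covered⁻ old
    ...   | f , f∈ , i with otherEnd i
    ...     | u , ends-f = pick (a ≟ u)
      where
      other : ∀ {a h} → NearLeaf r a h → a ≢ u → p ≢ a × ∃ (NearLeaf es a)
      other {a} {h} nh@(da , _) a≢u = (λ { refl → contradiction (sym d) (ℕ.<⇒≢ da) }) ,
        h , keepNearLeaf nh λ f′∈ _ ends-f′ _ → a≢u
          (sym (ends-unique ends-f (subst (λ f → Ends f p a)
            (deg≡1-unique d f′∈ (endsʳ ends-f′) f∈ i) (Sum.swap ends-f′))))

      pick : Dec (a ≡ u) → TwoNearLeaves es
      pick (no a≢u) = let p≢a , na = other nh a≢u in p , a , p≢a , (f , footNearLeaf d f∈ i) , na
      pick (yes refl) = let p≢b , nb = other nk (≢-sym a≢b) in p , b , p≢b , (f , footNearLeaf d f∈ i) , nb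

  -- The classical witnesses are the second and the last but one vertex of a longest path. Following
  -- the growth of the tree instead avoids choosing such a path.
  star⊎twoNearLeaves : ∀ {es} → Tree es → ∃ (StarAt es) ⊎ TwoNearLeaves es
  star⊎twoNearLeaves (single {a} {b} a≢b) = inj₁ (a , λ { (here refl) → b , inj₁ refl , trans (deg-∷ [] (inj₂ refl)) (cong suc (deg-[] b)) })
  star⊎twoNearLeaves (grow t g p) with star⊎twoNearLeaves t
  ... | inj₁ (c , s) = Sum.map (λ (c , s) → c , starAt-↭ (↭-sym p) s) (twoNearLeaves-↭ (↭-sym p))
                         (GrowNearLeaf.extendStar g t s)
  ... | inj₂ nl      = inj₂ (twoNearLeaves-↭ (↭-sym p) (GrowNearLeaf.extendNearLeaves g nl))

-- Paths and leaves

module _ {n : ℕ} where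

  record ThreeLeaves (es : List (Edge n)) : Set where
    constructor threeLeaves
    field
      {x y z} : Fin n
      x≢y   : x ≢ y
      x≢z   : x ≢ z
      y≢z   : y ≢ z
      deg-x : deg es x ≡ 1
      deg-y : deg es y ≡ 1
      deg-z : deg es z ≡ 1

  -- Mutually inverse numberings between the covered vertices and 0, ..., `length es`. Both maps are
  -- total; the inverse laws constrain them only on that range.
  record PathLayout (es : List (Edge n)) : Set where
    field
      pos        : Fin n → ℕ
      at         : ℕ → Fin n
      at-pos     : ∀ {v} → Covered es v → at (pos v) ≡ v
      pos-at     : ∀ {i} → i ≤ length es → pos (at i) ≡ i
      pos-≤      : ∀ {v} → Covered es v → pos v ≤ length es
      at-joined  : ∀ {i} → i < length es → Joined es (at i) (at (suc i))
      joined-pos : ∀ {u v} → Joined es u v → pos v ≡ suc (pos u) ⊎ pos u ≡ suc (pos v)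
      deg-first  : deg es (at 0) ≡ 1
      deg-last   : deg es (at (length es)) ≡ 1

  covered-length : ∀ {es : List (Edge n)} {v} → Covered es v → 1 ≤ length es
  covered-length (here _)  = s≤s z≤n
  covered-length (there _) = s≤s z≤n

  threeLeaves-↭ : ∀ {es fs} → es ↭ fs → ThreeLeaves es → ThreeLeaves fs
  threeLeaves-↭ p (threeLeaves xy xz yz dx dy dz) =
    threeLeaves xy xz yz (conv dx) (conv dy) (conv dz)
    where conv = λ {v} d → trans (sym (deg-↭ v p)) d

  layout-↭ : ∀ {es fs} → es ↭ fs → PathLayout es → PathLayout fs
  layout-↭ {es} {fs} p L = record
    { pos = pos; at = at
    ; at-pos     = at-pos ∘ covered-resp-↭ (↭-sym p)
    ; pos-at     = pos-at ∘ subst (_ ≤_) (sym len)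
    ; pos-≤      = subst (_ ≤_) len ∘ pos-≤ ∘ covered-resp-↭ (↭-sym p)
    ; at-joined  = Joined-resp-↭ p ∘ at-joined ∘ subst (_ <_) (sym len)
    ; joined-pos = joined-pos ∘ Joined-resp-↭ (↭-sym p)
    ; deg-first  = trans (sym (deg-↭ _ p)) deg-first
    ; deg-last   = trans (sym (deg-↭ _ p)) (subst (λ m → deg es (at m) ≡ 1) len deg-last)
    }
    where
    open PathLayout L
    len = Perm.↭-length p

  -- Reduces growth at the last vertex to growth at the first.
  layout-reverse : ∀ {es} → PathLayout es → PathLayout es
  layout-reverse {es} L = record
    { pos = λ v → m ∸ pos v
    ; at  = λ i → at (m ∸ i)
    ; at-pos     = λ c → trans (cong at (ℕ.m∸[m∸n]≡n (pos-≤ c))) (at-pos c)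
    ; pos-at     = λ {i} i≤ → trans (cong (m ∸_) (pos-at (ℕ.m∸n≤m m i))) (ℕ.m∸[m∸n]≡n i≤)
    ; pos-≤      = λ {v} _ → ℕ.m∸n≤m m (pos v)
    ; at-joined  = λ {i} i< → Sum.swap (subst (λ k → Joined es (at (m ∸ suc i)) (at k))
                     (sym (ℕ.+-∸-assoc 1 i<)) (at-joined (ℕ.∸-monoʳ-< (s≤s z≤n) i<)))
    ; joined-pos = λ j → Sum.swap (Sum.map (back (joined-covered (Sum.swap j))) (back (joined-covered j)) (joined-pos j))
    ; deg-first  = deg-last
    ; deg-last   = subst (λ k → deg es (at k) ≡ 1) (sym (ℕ.n∸n≡0 m)) deg-first
    }
    where
    open PathLayout L
    m = length es

    back : ∀ {u v} → Covered es v → pos v ≡ suc (pos u) → m ∸ pos u ≡ suc (m ∸ pos v)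
    back {u} {v} c eq = trans (ℕ.+-∸-assoc 1 (subst (_≤ m) eq (pos-≤ c))) (cong (λ k → suc (m ∸ k)) (sym eq))

  layout-single : ∀ {a b} → a ≢ b → PathLayout [ (a , b) ]
  layout-single {a} {b} a≢b = record
    { pos = pos; at = at
    ; at-pos     = λ { (here (inj₁ refl)) → cong at pos-a ; (here (inj₂ refl)) → cong at pos-b }
    ; pos-at     = λ { z≤n → pos-a ; (s≤s z≤n) → pos-b }
    ; pos-≤      = λ { (here (inj₁ refl)) → subst (_≤ 1) (sym pos-a) z≤n
                     ; (here (inj₂ refl)) → subst (_≤ 1) (sym pos-b) (s≤s z≤n) }
    ; at-joined  = λ { (s≤s z≤n) → inj₁ (here refl) }
    ; joined-pos = λ { (inj₁ (here refl)) → inj₁ (trans pos-b (cong suc (sym pos-a)))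
                     ; (inj₂ (here refl)) → inj₂ (trans pos-b (cong suc (sym pos-a))) }
    ; deg-first  = trans (deg-∷ [] (inj₁ refl)) (cong suc (deg-[] a))
    ; deg-last   = trans (deg-∷ [] (inj₂ refl)) (cong suc (deg-[] b))
    }
    where
    pos : Fin n → ℕ
    pos x with x ≟ a
    ... | yes _ = 0
    ... | no  _ = 1

    at : ℕ → Fin n
    at zero    = a
    at (suc _) = b

    pos-a : pos a ≡ 0
    pos-a with a ≟ a
    ... | yes _  = refl
    ... | no a≢a = contradiction refl a≢a

    pos-b : pos b ≡ 1
    pos-b with b ≟ a
    ... | yes refl = contradiction refl a≢b
    ... | no _     = refl

  module _ {r : List (Edge n)} {e : Edge n} (g : Grows r e) where
    open Grows g renaming (foot to p; tip to ℓ; footOld to old; tipNew to new)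
    open Growth g

    -- The tip takes position 0 and all old positions move up by one.
    layout-extend : (L : PathLayout r) → p ≡ PathLayout.at L 0 → PathLayout (e ∷ r)
    layout-extend L p≡ = record
      { pos = pos′; at = at′
      ; at-pos     = at-pos′
      ; pos-at     = λ { z≤n → pos-tip ; (s≤s i≤) → trans (pos-old (at-covered i≤)) (cong suc (pos-at i≤)) }
      ; pos-≤      = pos-≤′
      ; at-joined  = λ { {zero}  _        → Sum.map here here
                           (Sum.map (λ eq → trans (cong (ℓ ,_) (sym p≡)) (sym eq))
                                    (λ eq → trans (cong (_, ℓ) (sym p≡)) (sym eq)) (Sum.swap ends))
                       ; {suc i} (s≤s i<) → Sum.map there there (at-joined i<) }
      ; joined-pos = joined-pos′
      ; deg-first  = deg-tip
      ; deg-last   = trans (deg-old (at-covered ℕ.≤-refl) last≢p) deg-last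
      }
      where
      open PathLayout L
      m = length r

      pos′ : Fin n → ℕ
      pos′ x with x ≟ ℓ
      ... | yes _ = 0
      ... | no  _ = suc (pos x)

      at′ : ℕ → Fin n
      at′ zero    = ℓ
      at′ (suc i) = at i

      pos-tip : pos′ ℓ ≡ 0
      pos-tip with ℓ ≟ ℓ
      ... | yes _  = refl
      ... | no ℓ≢ℓ = contradiction refl ℓ≢ℓ

      pos-old : ∀ {v} → Covered r v → pos′ v ≡ suc (pos v)
      pos-old {v} c with v ≟ ℓ
      ... | yes v≡ = contradiction v≡ (old≢tip c)
      ... | no  _  = refl

      at-covered : ∀ {i} → i ≤ m → Covered r (at i)
      at-covered {zero}  _  = subst (Covered r) p≡ old
      at-covered {suc i} i< = joined-covered (Sum.swap (at-joined i<))

      covered-cases : ∀ {v} → Covered (e ∷ r) v → Covered r v ⊎ v ≡ ℓ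
      covered-cases (there c) = inj₁ c
      covered-cases (here i) with incident-ends ends i
      ... | inj₁ refl = inj₁ old
      ... | inj₂ v≡ℓ  = inj₂ v≡ℓ

      at-pos′ : ∀ {v} → Covered (e ∷ r) v → at′ (pos′ v) ≡ v
      at-pos′ c with covered-cases c
      ... | inj₁ c′   = trans (cong at′ (pos-old c′)) (at-pos c′)
      ... | inj₂ refl = cong at′ pos-tip

      pos-≤′ : ∀ {v} → Covered (e ∷ r) v → pos′ v ≤ suc m
      pos-≤′ c with covered-cases c
      ... | inj₁ c′   = subst (_≤ suc m) (sym (pos-old c′)) (s≤s (pos-≤ c′))
      ... | inj₂ refl = subst (_≤ suc m) (sym pos-tip) z≤n

      pos-p : pos′ p ≡ suc (pos′ ℓ)
      pos-p = trans (pos-old old) (trans (cong suc (trans (cong pos p≡) (pos-at z≤n))) (cong suc (sym pos-tip)))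

      end-pos : ∀ {u v} → Ends e u v → pos′ v ≡ suc (pos′ u) ⊎ pos′ u ≡ suc (pos′ v)
      end-pos ends′ with incident-ends ends (endsˡ ends′)
      ... | inj₁ refl with refl ← ends-unique ends ends′ = inj₂ pos-p
      ... | inj₂ refl with refl ← ends-unique (Sum.swap ends) ends′ = inj₁ pos-p

      joined-pos′ : ∀ {u v} → Joined (e ∷ r) u v → pos′ v ≡ suc (pos′ u) ⊎ pos′ u ≡ suc (pos′ v)
      joined-pos′ (inj₁ (here refl)) = end-pos (inj₁ refl)
      joined-pos′ (inj₂ (here refl)) = end-pos (inj₂ refl)
      joined-pos′ {u} {v} (inj₁ (there m))
        rewrite pos-old (joined-covered {u = u} {v} (inj₁ m)) | pos-old (joined-covered {u = v} {u} (inj₂ m)) =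
        Sum.map (cong suc) (cong suc) (joined-pos (inj₁ m))
      joined-pos′ {u} {v} (inj₂ (there m))
        rewrite pos-old (joined-covered {u = u} {v} (inj₂ m)) | pos-old (joined-covered {u = v} {u} (inj₁ m)) =
        Sum.map (cong suc) (cong suc) (joined-pos (inj₂ m))

      last≢p : at m ≢ p
      last≢p eq = ℕ.<⇒≢ (covered-length old) (trans (sym (pos-at z≤n)) (trans (cong pos (sym (trans eq p≡))) (pos-at ℕ.≤-refl)))

    -- If the foot is an inner vertex, both old ends remain leaves and the tip is a third.
    layout-grow : PathLayout r → PathLayout (e ∷ r) ⊎ ThreeLeaves (e ∷ r)
    layout-grow L with PathLayout.at L 0 ≟ p | PathLayout.at L (length r) ≟ p
    ... | yes first≡p | _           = inj₁ (layout-extend L (sym first≡p))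
    ... | no _        | yes last≡p  = inj₁ (layout-extend (layout-reverse L) (sym last≡p))
    ... | no first≢p  | no last≢p   = inj₂ (threeLeaves
      (λ eq → ℕ.<⇒≢ (covered-length old) (trans (sym (pos-at z≤n)) (trans (cong pos eq) (pos-at ℕ.≤-refl))))
      (old≢tip first-covered) (old≢tip last-covered)
      (trans (deg-old first-covered first≢p) deg-first)
      (trans (deg-old last-covered last≢p) deg-last)
      deg-tip)
      where
      open PathLayout L
      first-covered = covered-deg r (ℕ.≤-reflexive (sym deg-first))
      last-covered  = covered-deg r (ℕ.≤-reflexive (sym deg-last))

    leaf-old : ∀ {x} → deg r x ≡ 1 → Covered r x
    leaf-old d = covered-deg r (ℕ.≤-reflexive (sym d))

    -- A leaf that becomes the foot hands its role over to the tip, so growth never lowers the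
    -- number of leaves.
    follow : Fin n → Fin n
    follow x with x ≟ p
    ... | yes _ = ℓ
    ... | no  _ = x

    follow-leaf : ∀ {x} → deg r x ≡ 1 → deg (e ∷ r) (follow x) ≡ 1
    follow-leaf {x} d with x ≟ p
    ... | yes _   = deg-tip
    ... | no  x≢p = trans (deg-old (leaf-old d) x≢p) d

    follow-≢ : ∀ {x y} → deg r x ≡ 1 → deg r y ≡ 1 → x ≢ y → follow x ≢ follow y
    follow-≢ {x} {y} dx dy x≢y with x ≟ p | y ≟ p
    ... | yes refl | yes refl = contradiction refl x≢y
    ... | yes _    | no  _    = ≢-sym (old≢tip (leaf-old dy))
    ... | no  _    | yes _    = old≢tip (leaf-old dx)
    ... | no  _    | no  _    = x≢y

    threeLeaves-grow : ThreeLeaves r → ThreeLeaves (e ∷ r)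
    threeLeaves-grow (threeLeaves xy xz yz dx dy dz) =
      threeLeaves (follow-≢ dx dy xy) (follow-≢ dx dz xz) (follow-≢ dy dz yz)
        (follow-leaf dx) (follow-leaf dy) (follow-leaf dz)

  layout⊎threeLeaves : ∀ {es} → Tree es → PathLayout es ⊎ ThreeLeaves es
  layout⊎threeLeaves (single a≢b) = inj₁ (layout-single a≢b)
  layout⊎threeLeaves (grow t g p) =
    Sum.map (layout-↭ (↭-sym p)) (threeLeaves-↭ (↭-sym p))
      (Sum.[ layout-grow g , inj₂ ∘ threeLeaves-grow g ] (layout⊎threeLeaves t))

-- Bounds on the number of shellings

module _ {A : Set} where

  sum-mono : ∀ {f g : A → ℕ} xs → (∀ {x} → x ∈ xs → f x ≤ g x) → sum (map f xs) ≤ sum (map g xs)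
  sum-mono []       le = z≤n
  sum-mono (x ∷ xs) le = ℕ.+-mono-≤ (le (here refl)) (sum-mono xs (le ∘ there))

  sum-+ : ∀ (f g : A → ℕ) xs → sum (map (λ x → f x + g x) xs) ≡ sum (map f xs) + sum (map g xs)
  sum-+ f g []       = refl
  sum-+ f g (x ∷ xs) = trans (cong (f x + g x +_) (sum-+ f g xs))
    (solve 4 (λ a b c d → a :+ b :+ (c :+ d) := a :+ c :+ (b :+ d)) refl
      (f x) (g x) (sum (map f xs)) (sum (map g xs)))
    where open +-*-Solver

  sum-* : ∀ k (f : A → ℕ) xs → sum (map (λ x → k * f x) xs) ≡ k * sum (map f xs)
  sum-* k f []       = sym (ℕ.*-zeroʳ k)
  sum-* k f (x ∷ xs) = trans (cong (k * f x +_) (sum-* k f xs)) (sym (ℕ.*-distribˡ-+ k (f x) _))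

  sum-const : ∀ k (xs : List A) → sum (map (λ _ → k) xs) ≡ length xs * k
  sum-const k []       = refl
  sum-const k (x ∷ xs) = cong (k +_) (sum-const k xs)

  sum-picks : ∀ (f : A → ℕ) xs → sum (map (f ∘ proj₁) (picks xs)) ≡ sum (map f xs)
  sum-picks f xs = cong sum (trans (List.map-∘ (picks xs)) (cong (map f) (map-proj₁-picks xs)))

module _ {n : ℕ} where

  _≟ᵉ_ : DecidableEquality (Edge n)
  _≟ᵉ_ = Product.≡-dec _≟_ _≟_

  sum-≟ᵉ : ∀ h {es} → Unique es → sum (map (λ e → indicator (e ≟ᵉ h)) es) ≤ 1
  sum-≟ᵉ h []             = z≤n
  sum-≟ᵉ h {e ∷ es} (e∉ ∷ u) with e ≟ᵉ h
  ... | no _     = sum-≟ᵉ h u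
  ... | yes refl = s≤s (ℕ.≤-reflexive (rest es e∉))
    where
    rest : ∀ es → All (e ≢_) es → sum (map (λ f → indicator (f ≟ᵉ e)) es) ≡ 0
    rest []       All.[]         = refl
    rest (f ∷ es) (e≢f All.∷ e∉) = cong₂ _+_ (indicator-no (f ≟ᵉ e) (≢-sym e≢f)) (rest es e∉)

  -- The last-edge recursion multiplied by `k`, which clears the denominators of the edgewise
  -- bounds.
  count-picks-≤ : ∀ {es} → Tree es → (f : Edge n → ℕ) (k : ℕ) →
    (∀ {e r} → es ↭ e ∷ r → f e ≤ k * count r) → sum (map f es) ≤ k * count es
  count-picks-≤ {es} t f k le rewrite count-lastEdge (tree-unique t) (λ { refl → tree-nonempty t }) (tree-connected t)
    | sym (sum-* k (count ∘ proj₂) (picks es)) | sym (sum-picks f es) =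
    sum-mono (picks es) (le ∘ picks-↭ es)

  count-picks-≥ : ∀ {es} → Tree es → (f : Edge n → ℕ) (k : ℕ) →
    (∀ {e r} → es ↭ e ∷ r → k * count r ≤ f e) → k * count es ≤ sum (map f es)
  count-picks-≥ {es} t f k le rewrite count-lastEdge (tree-unique t) (λ { refl → tree-nonempty t }) (tree-connected t)
    | sym (sum-* k (count ∘ proj₂) (picks es)) | sym (sum-picks f es) =
    sum-mono (picks es) (le ∘ picks-↭ es)

  count-single : ∀ {e : Edge n} → Tree [ e ] → count [ e ] ≡ 1
  count-single t = trans (count-lastEdge (tree-unique t) (λ ()) (tree-connected t)) (cong (_+ 0) count-[])

  ∏deg!-single : ∀ (e : Edge n) → ∏deg! [ e ] ≡ 1
  ∏deg!-single e = trans (∏deg!-def [ e ]) (ones (allFin n))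
    where
    deg! : ∀ v → deg [ e ] v ! ≡ 1
    deg! v with incident? v e
    ... | yes i = cong _! (trans (deg-∷ [] i) (cong suc (deg-[] v)))
    ... | no ¬i = cong _! (trans (deg-∷-other [] ¬i) (deg-[] v))

    ones : ∀ vs → product (map (λ v → deg [ e ] v !) vs) ≡ 1
    ones []       = refl
    ones (v ∷ vs) = cong₂ _*_ (deg! v) (ones vs)

  deg-star : ∀ {es : List (Edge n)} {c} → StarAt es c → deg es c ≡ length es
  deg-star {es} {c} s = all es (λ f∈ → endsˡ (proj₁ (proj₂ (s f∈))))
    where
    all : ∀ fs → (∀ {f} → f ∈ fs → Incident c f) → deg fs c ≡ length fs
    all []       i = deg-[] c
    all (f ∷ fs) i = trans (deg-∷ fs (i (here refl))) (cong suc (all fs (i ∘ there)))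

  -- At least two edges, so that the rest after a removal is nonempty and again covers the foot.
  module Remove {es : List (Edge n)} (t : Tree es) {m : ℕ} (len : length es ≡ suc (suc m)) where

    length-rest : ∀ {e r} → es ↭ e ∷ r → length r ≡ suc m
    length-rest p = ℕ.suc-injective (trans (sym (Perm.↭-length p)) len)

    rest-nonempty : ∀ {e r} → es ↭ e ∷ r → r ≢ []
    rest-nonempty p refl with length-rest p
    ... | ()

    -- The edge `e` uses up the whole degree of `ℓ`, so `r` does not cover `ℓ` and `e` can be
    -- retracted onto `a`.
    removeLeaf : ∀ {e r a ℓ} → es ↭ e ∷ r → Ends e a ℓ → deg es ℓ ≡ 1 →
                 Tree r × Covered r a × ¬ Covered r ℓ
    removeLeaf {e} {r} {a} {ℓ} p ends d =
      proj₁ (tree-remove t p (rest-nonempty p) (Retract.connected ends new c)) ,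
      Retract.foot-covered ends new c (rest-nonempty p) , new
      where
      c : FormConnected (e ∷ r)
      c = FormConnected-resp-↭ p (tree-connected t)

      new : ¬ Covered r ℓ
      new cℓ = ℕ.<⇒≢ (deg-covered r cℓ)
        (sym (ℕ.suc-injective (trans (sym (deg-∷ r (endsʳ ends))) (trans (sym (deg-↭ ℓ p)) d))))

    ∏deg!-remove : ∀ {e r} (p : es ↭ e ∷ r) (g : Grows r e) →
                   ∏deg! es ≡ deg es (Grows.foot g) * ∏deg! r
    ∏deg!-remove p g rewrite ∏deg!-↭ p | deg-↭ (Grows.foot g) p = Growth.∏deg!-grow g

    foot-deg : ∀ {e r} (p : es ↭ e ∷ r) (g : Grows r e) → 2 ≤ deg es (Grows.foot g)
    foot-deg {r = r} p g rewrite deg-↭ (Grows.foot g) p | Growth.deg-foot g =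
      s≤s (deg-covered r (Grows.footOld g))

    -- Removing the leaf `y` leaves `x` as the foot in a nonempty rest, so `x` has degree at least
    -- 2.
    leaf-≢ : ∀ {e x y} → e ∈ es → Ends e x y → deg es x ≡ 1 → deg es y ≢ 1
    leaf-≢ {e} {x} e∈ ends dx dy with ∈⇒↭ e∈
    ... | r , p with removeLeaf p ends dy
    ...   | _ , cx , new = ℕ.<⇒≢ (foot-deg p (grows ends cx new)) (sym dx)

    module Lower (ih : ∀ {e : Edge n} {r : List (Edge n)} → es ↭ e ∷ r → Tree r → ∏deg! r ≤ count r) where

      leaf-bound : ∀ {e r a} → es ↭ e ∷ r → LeafEdge es a e → ∏deg! es ≤ deg es a * count r
      leaf-bound {a = a} p (ℓ , ends , d) with removeLeaf p ends d
      ... | tr , ca , new rewrite ∏deg!-remove p (grows ends ca new) = ℕ.*-monoʳ-≤ (deg es a) (ih p tr)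

      leaf-count : ∀ {e r v} → es ↭ e ∷ r → Incident v e → deg es v ≡ 1 → 1 ≤ count r
      leaf-count {r = r} p i d with otherEnd i
      ... | _ , ends = ℕ.≤-trans (∏deg!>0 r) (ih p (proj₁ (removeLeaf p (Sum.swap ends) d)))

      star-lower : ∀ {c} → StarAt es c → ∏deg! es * length es ≤ deg es c * count es
      star-lower {c} s = subst (_≤ deg es c * count es)
        (trans (sum-const (∏deg! es) es) (ℕ.*-comm (length es) _))
        (count-picks-≤ t (λ _ → ∏deg! es) (deg es c)
          (λ p → leaf-bound p (s (Perm.∈-resp-↭ (↭-sym p) (here refl)))))

      -- The leaf edges at a and b alone give the bound; mark singles out leaf edges, and having
      -- more than two of them makes it strict.
      module _ {a b : Fin n} {h k : Edge n} (a≢b : a ≢ b) (na : NearLeaf es a h) (nb : NearLeaf es b k)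
               (mark : Edge n → ℕ) (mark≤1 : ∀ {e : Edge n} → e ∈ es → mark e ≤ 1)
               (mark-leaf : ∀ {e : Edge n} → 1 ≤ mark e → ∃ λ (v : Fin n) → Incident v e × deg es v ≡ 1) where

        private
          P  = ∏deg! es
          dᵃ = deg es a
          dᵇ = deg es b

          good : ∀ v g (e : Edge n) → Dec (Incident v e × e ≢ g)
          good v g e = incident? v e ×-dec ¬? (e ≟ᵉ g)

          -- `A` and `B` indicate the guaranteed leaf edges at `a` and `b`; `X` keeps the marks on
          -- all other edges. It vanishes on the guaranteed ones because a mark is at most 1.
          A B X : Edge n → ℕ
          A e = indicator (good a h e)
          B e = indicator (good b k e)
          X e = mark e ∸ (A e + B e)

        -- Of the edges at `v` only `g` is excluded, and it occurs at most once.
        deg-good : ∀ v g → deg es v ≤ suc (sum (map (λ e → indicator (good v g e)) es))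
        deg-good v g = begin
          deg es v                       ≡⟨ deg-sum es v ⟩
          sum (map (inc v) es)           ≤⟨ sum-mono es (λ {e} _ → split e) ⟩
          sum (map (λ e → indicator (e ≟ᵉ g) + indicator (good v g e)) es)
                                         ≡⟨ sum-+ (λ e → indicator (e ≟ᵉ g)) (λ e → indicator (good v g e)) es ⟩
          sum (map (λ e → indicator (e ≟ᵉ g)) es) + sum (map (λ e → indicator (good v g e)) es)
                                         ≤⟨ ℕ.+-monoˡ-≤ _ (sum-≟ᵉ g (tree-unique t)) ⟩
          suc (sum (map (λ e → indicator (good v g e)) es)) ∎
          where
          open ℕ.≤-Reasoning
          split : ∀ e → inc v e ≤ indicator (e ≟ᵉ g) + indicator (good v g e)
          split e = cases (incident? v e) (e ≟ᵉ g)
            where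
            cases : Dec (Incident v e) → Dec (e ≡ g) → inc v e ≤ indicator (e ≟ᵉ g) + indicator (good v g e)
            cases (no ¬i) _ rewrite inc-no ¬i = z≤n
            cases (yes i) (yes e≡) rewrite inc-yes i | indicator-yes (e ≟ᵉ g) e≡ = s≤s z≤n
            cases (yes i) (no e≢) rewrite inc-yes i | indicator-yes (good v g e) (i , e≢) = ℕ.m≤n+m 1 _

        -- After multiplication by d(a) d(b), a leaf edge at `a` is worth at least d(b) P, one at
        -- `b` at least d(a) P, and any other marked edge at least 1, since its rest has a shelling.
        -- The classes do not overlap: a leaf edge at `a` ends in a leaf, and `b` is none.
        edge-bound : ∀ {e r} → es ↭ e ∷ r →
          dᵇ * P * A e + dᵃ * P * B e + X e ≤ dᵃ * dᵇ * count r
        edge-bound {e} {r} p = cases (good a h e) (good b k e)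
          where
          open ℕ.≤-Reasoning
          e∈ : e ∈ es
          e∈ = Perm.∈-resp-↭ (↭-sym p) (here refl)

          other : ∀ {v w} → v ≢ w → LeafEdge es v e → 2 ≤ deg es w → ¬ Incident w e
          other v≢w (ℓ , ends , d) dw i with incident-ends ends i
          ... | inj₁ refl = v≢w refl
          ... | inj₂ refl = ℕ.<⇒≢ dw (sym d)

          cases : Dec (Incident a e × e ≢ h) → Dec (Incident b e × e ≢ k) →
            dᵇ * P * A e + dᵃ * P * B e + X e ≤ dᵃ * dᵇ * count r
          cases (yes (i , e≢)) _
            with leaf ← proj₂ na e∈ i e≢
            rewrite indicator-yes (good a h e) (i , e≢)
                  | indicator-no (good b k e) (other a≢b leaf (proj₁ nb) ∘ proj₁)
                  | ℕ.m≤n⇒m∸n≡0 (mark≤1 e∈) = begin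
              dᵇ * P * 1 + dᵃ * P * 0 + 0
                ≡⟨ solve 3 (λ x y z → x :* y :* con 1 :+ z :* y :* con 0 :+ con 0 := x :* y) refl dᵇ P dᵃ ⟩
              dᵇ * P                  ≤⟨ ℕ.*-monoʳ-≤ dᵇ (leaf-bound p leaf) ⟩
              dᵇ * (dᵃ * count r)
                ≡⟨ solve 3 (λ x y z → y :* (x :* z) := x :* y :* z) refl dᵃ dᵇ (count r) ⟩
              dᵃ * dᵇ * count r       ∎
              where open +-*-Solver
          cases (no ¬a) (yes (i , e≢))
            with leaf ← proj₂ nb e∈ i e≢
            rewrite indicator-no (good a h e) ¬a
                  | indicator-yes (good b k e) (i , e≢)
                  | ℕ.m≤n⇒m∸n≡0 (mark≤1 e∈) = begin
              dᵇ * P * 0 + dᵃ * P * 1 + 0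
                ≡⟨ solve 3 (λ x y z → x :* y :* con 0 :+ z :* y :* con 1 :+ con 0 := z :* y) refl dᵇ P dᵃ ⟩
              dᵃ * P                  ≤⟨ ℕ.*-monoʳ-≤ dᵃ (leaf-bound p leaf) ⟩
              dᵃ * (dᵇ * count r)     ≡⟨ sym (ℕ.*-assoc dᵃ dᵇ (count r)) ⟩
              dᵃ * dᵇ * count r       ∎
              where open +-*-Solver
          cases (no ¬a) (no ¬b)
            rewrite indicator-no (good a h e) ¬a | indicator-no (good b k e) ¬b
                  | ℕ.*-zeroʳ (dᵇ * P) | ℕ.*-zeroʳ (dᵃ * P) with mark e | mark≤1 e∈ | mark-leaf {e}
          ... | zero  | _       | _ = z≤n
          ... | suc _ | s≤s z≤n | f with f (s≤s z≤n)
          ...   | v , i , d = ℕ.*-mono-≤ (ℕ.*-mono-≤ (ℕ.<⇒≤ (proj₁ na)) (ℕ.<⇒≤ (proj₁ nb))) (leaf-count p i d)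

        private
          SA = sum (map A es)
          SB = sum (map B es)
          SX = sum (map X es)
          SM = sum (map mark es)

        total : dᵇ * P * SA + dᵃ * P * SB + SX ≤ dᵃ * dᵇ * count es
        total = subst (_≤ dᵃ * dᵇ * count es)
          (trans (sum-+ _ X es) (cong (_+ SX)
            (trans (sum-+ (λ e → dᵇ * P * A e) (λ e → dᵃ * P * B e) es) (cong₂ _+_ (sum-* (dᵇ * P) A es) (sum-* (dᵃ * P) B es)))))
          (count-picks-≤ t (λ e → dᵇ * P * A e + dᵃ * P * B e + X e) (dᵃ * dᵇ) edge-bound)

        marked : SM ≤ SA + SB + SX
        marked = begin
          SM                                             ≤⟨ sum-mono es (λ {e} _ → ℕ.m≤n+m∸n (mark e) (A e + B e)) ⟩
          sum (map (λ e → A e + B e + X e) es)           ≡⟨ sum-+ (λ e → A e + B e) X es ⟩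
          sum (map (λ e → A e + B e) es) + SX            ≡⟨ cong (_+ SX) (sum-+ A B es) ⟩
          SA + SB + SX                                   ∎
          where open ℕ.≤-Reasoning

        -- One leaf edge at `a` and one at `b`, both guaranteed by degrees of at least 2, are
        -- absorbed in d(a) d(b) P. Every mark beyond these two leaves a surplus of at least 1.
        nearLeaves-bound : dᵃ * dᵇ * P + (SM ∸ 2) ≤ dᵃ * dᵇ * count es
        nearLeaves-bound = ℕ.≤-trans
          (arith dᵃ dᵇ SA SB SX SM P (proj₁ na) (proj₁ nb) (deg-good a h) (deg-good b k) (∏deg!>0 es) marked)
          total
          where
          arith : ∀ dᵃ dᵇ A B X M P → 2 ≤ dᵃ → 2 ≤ dᵇ → dᵃ ≤ suc A → dᵇ ≤ suc B → 1 ≤ P → M ≤ A + B + X →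
                  dᵃ * dᵇ * P + (M ∸ 2) ≤ dᵇ * P * A + dᵃ * P * B + X
          -- `i` and `j` are the degrees in excess of 2. In `core`, `s` and `t` become the leaf
          -- edges in excess of d(a) - 1 and d(b) - 1.
          arith (suc (suc i)) (suc (suc j)) (suc s) (suc t) X M P _ _ (s≤s (s≤s i≤s)) (s≤s (s≤s j≤t)) 1≤P M≤ =
            subst₂ (λ s t → M ≤ suc s + suc t + X → (2 + i) * (2 + j) * P + (M ∸ 2) ≤ (2 + j) * P * suc s + (2 + i) * P * suc t + X)
              (ℕ.m+[n∸m]≡n i≤s) (ℕ.m+[n∸m]≡n j≤t) (core (s ∸ i) (t ∸ j)) M≤
            where
            core : ∀ s t → M ≤ suc (i + s) + suc (j + t) + X →
              (2 + i) * (2 + j) * P + (M ∸ 2) ≤ (2 + j) * P * suc (i + s) + (2 + i) * P * suc (j + t) + X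
            core s t M≤ = begin
              (2 + i) * (2 + j) * P + (M ∸ 2)
                ≤⟨ ℕ.+-monoʳ-≤ ((2 + i) * (2 + j) * P) (ℕ.≤-trans (ℕ.∸-monoˡ-≤ 2 M≤) (ℕ.≤-reflexive (cong (λ x → x + X ∸ 1) (ℕ.+-suc (i + s) (j + t))))) ⟩
              (2 + i) * (2 + j) * P + (i + s + (j + t) + X)
                ≡⟨ cong (λ x → (2 + i) * (2 + j) * P + (x + X)) (sym (ℕ.*-identityˡ (i + s + (j + t)))) ⟩
              (2 + i) * (2 + j) * P + (1 * (i + s + (j + t)) + X)
                ≤⟨ ℕ.+-monoʳ-≤ ((2 + i) * (2 + j) * P) (ℕ.+-monoˡ-≤ X (ℕ.*-monoˡ-≤ (i + s + (j + t)) 1≤P)) ⟩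
              (2 + i) * (2 + j) * P + (P * (i + s + (j + t)) + X)
                -- The weighted leaf edges exceed d(a) d(b) P by P (ij + i + j + (2+j)s + (2+i)t);
                -- the marks need only P (i + s + j + t), and this is the difference.
                ≤⟨ ℕ.m≤m+n _ (P * (i * j + (1 + j) * s + (1 + i) * t)) ⟩
              (2 + i) * (2 + j) * P + (P * (i + s + (j + t)) + X) + P * (i * j + (1 + j) * s + (1 + i) * t)
                ≡⟨ solve 6 (λ i j s t P X →
                     (con 2 :+ i) :* (con 2 :+ j) :* P :+ (P :* (i :+ s :+ (j :+ t)) :+ X)
                       :+ P :* (i :* j :+ (con 1 :+ j) :* s :+ (con 1 :+ i) :* t)
                     := (con 2 :+ j) :* P :* (con 1 :+ (i :+ s)) :+ (con 2 :+ i) :* P :* (con 1 :+ (j :+ t)) :+ X)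
                   refl i j s t P X ⟩
              (2 + j) * P * suc (i + s) + (2 + i) * P * suc (j + t) + X ∎
              where
              open ℕ.≤-Reasoning
              open +-*-Solver
          arith (suc (suc _)) _ zero _ _ _ _ _ _ (s≤s ()) _ _ _
          arith (suc (suc _)) (suc (suc _)) (suc _) zero _ _ _ _ _ _ (s≤s ()) _ _
          arith (suc zero) _ _ _ _ _ _ (s≤s ())
          arith (suc (suc _)) (suc zero) _ _ _ _ _ _ (s≤s ())

      lower-step : ∏deg! es ≤ count es
      lower-step with star⊎twoNearLeaves t
      ... | inj₁ (c , s) = ℕ.*-cancelˡ-≤ (length es) {{>-nonZero (subst (1 ≤_) (sym len) (s≤s z≤n))}}
        (subst₂ _≤_ (ℕ.*-comm _ (length es)) (cong (_* count es) (deg-star s)) (star-lower s))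
      -- The zero marking suffices here, as no surplus is sought.
      ... | inj₂ (a , b , a≢b , (h , na) , (k , nb)) =
        ℕ.*-cancelˡ-≤ (deg es a * deg es b)
          {{>-nonZero (ℕ.*-mono-≤ (ℕ.<⇒≤ (proj₁ na)) (ℕ.<⇒≤ (proj₁ nb)))}}
          (ℕ.≤-trans (ℕ.m≤m+n _ _) (nearLeaves-bound a≢b na nb (λ _ → 0) (λ _ → z≤n) (λ ())))

      -- Marking the edges at the three leaves gives total 3, one more than `nearLeaves-bound`
      -- absorbs.
      strict-step : TwoNearLeaves es → ThreeLeaves es →
                     ∏deg! es < count es
      strict-step (a , b , a≢b , (h , na) , (k , nb)) (threeLeaves {x} {y} {z} x≢y x≢z y≢z dx dy dz) =
        ℕ.*-cancelˡ-< (deg es a * deg es b) _ _ (begin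
          suc (deg es a * deg es b * ∏deg! es)                        ≡⟨ ℕ.+-comm 1 _ ⟩
          deg es a * deg es b * ∏deg! es + 1
            ≡⟨ cong (λ k → deg es a * deg es b * ∏deg! es + (k ∸ 2)) (sym total-marks) ⟩
          deg es a * deg es b * ∏deg! es + (sum (map mark es) ∸ 2)
            ≤⟨ nearLeaves-bound a≢b na nb mark mark≤1 mark-leaf ⟩
          deg es a * deg es b * count es                              ∎)
        where
        open ℕ.≤-Reasoning
        mark : Edge n → ℕ
        mark e = inc x e + inc y e + inc z e

        total-marks : sum (map mark es) ≡ 3
        total-marks = trans (sum-+ (λ e → inc x e + inc y e) (inc z) es)
          (cong₂ _+_ (trans (sum-+ (inc x) (inc y) es)
            (cong₂ _+_ (trans (sym (deg-sum es x)) dx) (trans (sym (deg-sum es y)) dy)))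
            (trans (sym (deg-sum es z)) dz))

        -- Two leaves never share an edge here, so no edge is marked twice.
        exclude : ∀ {u v e} → e ∈ es → deg es u ≡ 1 → deg es v ≡ 1 → u ≢ v → Incident u e → ¬ Incident v e
        exclude e∈ du dv u≢v i j with otherEnd i
        ... | w , ends with incident-ends ends j
        ...   | inj₁ refl = u≢v refl
        ...   | inj₂ refl = leaf-≢ e∈ ends du dv

        mark≤1 : ∀ {e} → e ∈ es → mark e ≤ 1
        mark≤1 {e} e∈ with incident? x e | incident? y e | incident? z e
        ... | yes i | _ | _ rewrite inc-yes i | inc-no (exclude e∈ dx dy x≢y i) | inc-no (exclude e∈ dx dz x≢z i) = s≤s z≤n
        ... | no ¬i | yes j | _ rewrite inc-no ¬i | inc-yes j | inc-no (exclude e∈ dy dz y≢z j) = s≤s z≤n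
        ... | no ¬i | no ¬j | yes l rewrite inc-no ¬i | inc-no ¬j | inc-yes l = s≤s z≤n
        ... | no ¬i | no ¬j | no ¬l rewrite inc-no ¬i | inc-no ¬j | inc-no ¬l = z≤n

        mark-leaf : ∀ {e} → 1 ≤ mark e → ∃ λ v → Incident v e × deg es v ≡ 1
        mark-leaf {e} m≥1 with incident? x e | incident? y e | incident? z e
        ... | yes i | _ | _ = x , i , dx
        ... | no ¬i | yes j | _ = y , j , dy
        ... | no ¬i | no ¬j | yes l = z , l , dz
        ... | no ¬i | no ¬j | no ¬l rewrite inc-no ¬i | inc-no ¬j | inc-no ¬l with m≥1
        ...   | ()

  -- Lower and upper bounds by induction on the number of edges.

  count-lower : ∀ m {es : List (Edge n)} → length es ≡ suc m → Tree es → ∏deg! es ≤ count es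
  count-lower zero {e ∷ []} refl t = ℕ.≤-reflexive (trans (∏deg!-single e) (sym (count-single t)))
  count-lower (suc m) len t =
    Remove.Lower.lower-step t len (λ p → count-lower m (Remove.length-rest t len p))

  count-strict : ∀ {m} {es : List (Edge n)} → length es ≡ suc (suc m) → Tree es → TwoNearLeaves es → ThreeLeaves es →
                 ∏deg! es < count es
  count-strict {m} len t =
    Remove.Lower.strict-step t len (λ p → count-lower m (Remove.length-rest t len p))

  -- Each of the d(c) edges is pendant at `c` and contributes at most P / d(c), since the rest is
  -- again a star at `c`.
  count-star : ∀ m {es : List (Edge n)} {c} → length es ≡ suc m → Tree es → StarAt es c → count es ≤ ∏deg! es
  count-star zero {e ∷ []} refl t s = ℕ.≤-reflexive (trans (count-single t) (sym (∏deg!-single e)))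
  count-star (suc m) {es} {c} len t s =
    ℕ.*-cancelˡ-≤ (deg es c) {{>-nonZero (subst (1 ≤_) (sym (trans (deg-star s) len)) (s≤s z≤n))}}
      (subst (deg es c * count es ≤_) (trans (sum-const (∏deg! es) es) (cong (_* ∏deg! es) (sym (deg-star s))))
        (count-picks-≥ t (λ _ → ∏deg! es) (deg es c) bound))
    where
    open Remove t len

    star-rest : ∀ {e r} → es ↭ e ∷ r → StarAt r c
    star-rest {e} {r} p f∈ with s (Perm.∈-resp-↭ (↭-sym p) (there f∈))
    ... | x , ends , d = x , ends , ℕ.≤-antisym
      (ℕ.≤-trans (deg-∷-≤ {e = e} r) (ℕ.≤-reflexive (trans (sym (deg-↭ x p)) d)))
      (deg-covered r (covered⁺ f∈ (endsʳ ends)))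

    bound : ∀ {e r} → es ↭ e ∷ r → deg es c * count r ≤ ∏deg! es
    bound p with s (Perm.∈-resp-↭ (↭-sym p) (here refl))
    ... | x , ends , d with removeLeaf p ends d
    ...   | tr , cc , new rewrite ∏deg!-remove p (grows ends cc new) =
      ℕ.*-monoʳ-≤ (deg es c) (count-star m (length-rest p) tr (star-rest p))

  -- `a` and `b` may coincide or have degree 0, which keeps the notion closed under removal of a
  -- pendant edge. The degree bounds limit the number of incidences with `a` and `b` to 2.
  record AtMostTwoLeaves (es : List (Edge n)) : Set where
    constructor atMostTwoLeaves
    field
      {a b} : Fin n
      deg-a : deg es a ≤ 1
      deg-b : deg es b ≤ 1
      leaf  : ∀ {v} → deg es v ≡ 1 → v ≡ a ⊎ v ≡ b

  -- The tip is `a` or `b`, and removing it makes at most one new leaf, the foot, which takes its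
  -- place.
  atMostTwoLeaves-rest : ∀ {es : List (Edge n)} {e r} → es ↭ e ∷ r → Grows r e → AtMostTwoLeaves es → AtMostTwoLeaves r
  atMostTwoLeaves-rest {es} {e} {r} p g@(grows {q} {ℓ} ends old new) (atMostTwoLeaves {a} {b} da db lf) =
    Sum.[ (λ ℓ≡a → two db (λ d → Sum.[ (λ v≡a → inj₁ (trans v≡a (sym ℓ≡a))) , inj₂ ] (lf d)))
        , (λ ℓ≡b → two da (λ d → Sum.[ inj₂ , (λ v≡b → inj₁ (trans v≡b (sym ℓ≡b))) ] (lf d))) ]
      (lf (trans (deg-↭ ℓ p) deg-tip))
    where
    open Growth g
    two : ∀ {c} → deg es c ≤ 1 → (∀ {v} → deg es v ≡ 1 → v ≡ ℓ ⊎ v ≡ c) → AtMostTwoLeaves r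
    two {c} dc lf′ = cases (deg r q ℕ.≟ 1)
      where
      dc′ : deg r c ≤ 1
      dc′ = ℕ.≤-trans (deg-∷-≤ {e = e} r) (subst (_≤ 1) (deg-↭ c p) dc)

      old-leaf : ∀ {v} → v ≢ q → deg r v ≡ 1 → v ≡ c
      old-leaf {v} v≢q dv with covered-deg r (ℕ.≤-reflexive (sym dv))
      ... | cv with lf′ (trans (deg-↭ v p) (trans (deg-old cv v≢q) dv))
      ...   | inj₁ refl = contradiction cv new
      ...   | inj₂ v≡c  = v≡c

      cases : Dec (deg r q ≡ 1) → AtMostTwoLeaves r
      -- The foot is no leaf of `r`, so `c` is the only candidate and is listed twice.
      cases (no d≢1) = atMostTwoLeaves dc′ dc′ (λ dv → inj₁ (old-leaf (λ { refl → d≢1 dv }) dv))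
      cases (yes d)  = atMostTwoLeaves (ℕ.≤-reflexive d) dc′ leaf
        where
        leaf : ∀ {v} → deg r v ≡ 1 → v ≡ q ⊎ v ≡ c
        leaf {v} dv with v ≟ q
        ... | yes v≡q = inj₁ v≡q
        ... | no v≢q  = inj₂ (old-leaf v≢q dv)

  -- The foot of a pendant edge has degree at least 2, so its term is at most P / 2. Every pendant
  -- edge meets `a` or `b`, and there are at most two such incidences.
  count-path : ∀ m {es : List (Edge n)} → length es ≡ suc m → Tree es → AtMostTwoLeaves es → count es ≤ ∏deg! es
  count-path zero {e ∷ []} refl t _ = ℕ.≤-reflexive (trans (count-single t) (sym (∏deg!-single e)))
  count-path (suc m) {es} len t two@(atMostTwoLeaves {a} {b} da db lf) =
    ℕ.*-cancelˡ-≤ 2 (begin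
      2 * count es                                       ≤⟨ count-picks-≥ t (λ e → ∏deg! es * (inc a e + inc b e)) 2 bound ⟩
      sum (map (λ e → ∏deg! es * (inc a e + inc b e)) es) ≡⟨ sum-* (∏deg! es) (λ e → inc a e + inc b e) es ⟩
      ∏deg! es * sum (map (λ e → inc a e + inc b e) es)  ≡⟨ cong (∏deg! es *_) (sum-+ (inc a) (inc b) es) ⟩
      ∏deg! es * (sum (map (inc a) es) + sum (map (inc b) es))
        ≡⟨ cong (∏deg! es *_) (cong₂ _+_ (sym (deg-sum es a)) (sym (deg-sum es b))) ⟩
      ∏deg! es * (deg es a + deg es b)                   ≤⟨ ℕ.*-monoʳ-≤ (∏deg! es) (ℕ.+-mono-≤ da db) ⟩
      ∏deg! es * 2                                       ≡⟨ ℕ.*-comm (∏deg! es) 2 ⟩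
      2 * ∏deg! es                                       ∎)
    where
    open Remove t len
    open ℕ.≤-Reasoning

    incident-leaf : ∀ {v e} → Incident v e → v ≡ a ⊎ v ≡ b → 1 ≤ inc a e + inc b e
    incident-leaf {e = e} i (inj₁ refl) = ℕ.≤-trans (ℕ.≤-reflexive (sym (inc-yes i))) (ℕ.m≤m+n _ (inc b e))
    incident-leaf {e = e} i (inj₂ refl) = ℕ.≤-trans (ℕ.≤-reflexive (sym (inc-yes i))) (ℕ.m≤n+m _ (inc a e))

    bound : ∀ {e r} → es ↭ e ∷ r → 2 * count r ≤ ∏deg! es * (inc a e + inc b e)
    bound {e} {r} p with formConnected? r
    -- A disconnected rest contributes nothing; in the other case `tree-remove` shows that `e` is
    -- pendant.
    ... | no ¬c rewrite count-disconnected r ¬c = z≤n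
    ... | yes c with tree-remove t p (rest-nonempty p) c
    ...   | tr , g = begin
      2 * count r                        ≤⟨ ℕ.*-mono-≤ (foot-deg p g) (count-path m (length-rest p) tr (atMostTwoLeaves-rest p g two)) ⟩
      deg es (Grows.foot g) * ∏deg! r    ≡⟨ sym (∏deg!-remove p g) ⟩
      ∏deg! es                           ≡⟨ sym (ℕ.*-identityʳ _) ⟩
      ∏deg! es * 1                       ≤⟨ ℕ.*-monoʳ-≤ (∏deg! es) (incident-leaf (endsʳ (Grows.ends g))
                                              (lf (trans (deg-↭ _ p) (Growth.deg-tip g)))) ⟩
      ∏deg! es * (inc a e + inc b e)     ∎

-- The edge list of a tree

open Graph

sum-indicator : ∀ {A : Set} {P : A → Set} (P? : Decidable P) xs →
  sum (map (λ x → indicator (P? x)) xs) ≡ length (filter P? xs)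
sum-indicator P? []       = refl
sum-indicator P? (x ∷ xs) with P? x
... | yes _ = cong suc (sum-indicator P? xs)
... | no  _ = sum-indicator P? xs

-- The index lists the vertices after the first, so `x ∷ ws` is the full vertex list, in the form
-- that `IsCycle` expects.
data Walk {A : Set} (R : Rel A 0ℓ) : A → A → List A → Set where
  []  : ∀ {x} → Walk R x x []
  _∷_ : ∀ {x y w ws} → R x w → Walk R w y ws → Walk R x y (w ∷ ws)

module _ {n : ℕ} {R : Rel (Fin n) 0ℓ} where

  walk-from : ∀ {x y z ws} → Unique (x ∷ ws) → Walk R x y ws → z ∈ x ∷ ws →
              ∃ λ ws′ → Unique (z ∷ ws′) × Walk R z y ws′
  walk-from u       w       (here refl) = _ , u , w
  walk-from (_ ∷ u) (r ∷ w) (there z∈)  = walk-from u w z∈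

  open import Data.List.Membership.DecPropositional (_≟_ {n}) using (_∈?_)

  -- If the remaining simple walk already visits `x`, the detour is cut off by starting at that
  -- visit.
  simpleWalk : ∀ {x y} → Star R x y → ∃ λ ws → Unique (x ∷ ws) × Walk R x y ws
  simpleWalk ε = [] , All.[] ∷ [] , []
  simpleWalk {x} (_◅_ {j = w} r p) with simpleWalk p
  ... | ws , u , wk with x ∈? w ∷ ws
  ...   | yes x∈ = walk-from u wk x∈
  ...   | no x∉  = w ∷ ws , All.tabulate (λ { z∈ refl → x∉ z∈ }) ∷ u , r ∷ wk

  walk-linked : ∀ {S : Rel (Fin n) 0ℓ} {x y z ws} → (∀ {u v} → R u v → S u v) →
                Walk R x y ws → S y z → Linked S (x ∷ (ws ∷ʳ z))
  walk-linked R⊆S []      s = s ∷ [-]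
  walk-linked R⊆S (r ∷ w) s = R⊆S r ∷ walk-linked R⊆S w s

  crossing : ∀ {P : Fin n → Set} → Decidable P → ∀ {x y} → Star R x y → P x → ¬ P y →
             ∃₂ λ u v → R u v × P u × ¬ P v
  crossing P? ε px ¬py = contradiction px ¬py
  crossing P? (_◅_ {i = x} {j = w} r p) px ¬py with P? w
  ... | yes pw = crossing P? p pw ¬py
  ... | no ¬pw = x , w , r , px , ¬pw

module _ {n : ℕ} (G : Graph n) where

  private
    oriented? : Decidable (λ ((i , j) : Edge n) → i Fin.< j × Adj G i j)
    oriented? (i , j) = (i Fin.<? j) ×-dec adj? G i j

  ∈-edges⁺ : ∀ {i j} → i Fin.< j → Adj G i j → (i , j) ∈ edges G
  ∈-edges⁺ {i} {j} i<j adj =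
    ∈-filter⁺ oriented? (∈-cartesianProduct⁺ (∈-allFin i) (∈-allFin j)) (i<j , adj)

  ∈-edges⁻ : ∀ {i j} → (i , j) ∈ edges G → i Fin.< j × Adj G i j
  ∈-edges⁻ e∈ = proj₂ (∈-filter⁻ oriented? {xs = cartesianProduct (allFin n) (allFin n)} e∈)

  adj-joined : ∀ {u v} → Adj G u v → Joined (edges G) u v
  adj-joined {u} {v} adj with Fin.<-cmp u v
  ... | tri< u<v _ _  = inj₁ (∈-edges⁺ u<v adj)
  ... | tri≈ _ refl _ = contradiction adj (irrefl G refl)
  ... | tri> _ _ v<u  = inj₂ (∈-edges⁺ v<u (symm G adj))

  joined-adj : ∀ {u v} → Joined (edges G) u v → Adj G u v
  joined-adj (inj₁ e∈) = proj₂ (∈-edges⁻ e∈)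
  joined-adj (inj₂ e∈) = symm G (proj₂ (∈-edges⁻ e∈))

  private
    edgeBetween : Fin n → Fin n → Edge n
    edgeBetween u v with u Fin.<? v
    ... | yes _ = u , v
    ... | no  _ = v , u

    edgeBetween-ends : ∀ u v → Ends (edgeBetween u v) u v
    edgeBetween-ends u v with u Fin.<? v
    ... | yes _ = inj₁ refl
    ... | no  _ = inj₂ refl

    edgeBetween-∈ : ∀ {u v} → Adj G u v → edgeBetween u v ∈ edges G
    edgeBetween-∈ {u} {v} adj with u Fin.<? v | adj-joined adj
    ... | yes _  | inj₁ e∈ = e∈
    ... | yes lt | inj₂ e∈ = contradiction (proj₁ (∈-edges⁻ e∈)) (Fin.<-asym lt)
    ... | no ¬lt | inj₁ e∈ = contradiction (proj₁ (∈-edges⁻ e∈)) ¬lt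
    ... | no _   | inj₂ e∈ = e∈

    edgeBetween-unique : ∀ {u v e} → e ∈ edges G → Ends e u v → e ≡ edgeBetween u v
    edgeBetween-unique {u} {v} e∈ ends with u Fin.<? v
    edgeBetween-unique e∈ (inj₁ refl) | yes _  = refl
    edgeBetween-unique e∈ (inj₂ refl) | yes lt = contradiction (proj₁ (∈-edges⁻ e∈)) (Fin.<-asym lt)
    edgeBetween-unique e∈ (inj₁ refl) | no ¬lt = contradiction (proj₁ (∈-edges⁻ e∈)) ¬lt
    edgeBetween-unique e∈ (inj₂ refl) | no _   = refl

  opaque
    unfolding deg inc

    -- Joining `v` to each neighbour is a bijection from neighbours to incident edges, as every edge
    -- is stored in one orientation only.
    degree≡deg : ∀ v → degree G v ≡ deg (edges G) v
    degree≡deg v = trans (sym (List.length-map (edgeBetween v) neighbours))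
      (trans (Perm.↭-length (unique∧sameMembers⇒↭
        (Unique.map⁺ injective (Unique.filter⁺ (adj? G v) (Unique.allFin⁺ n)))
        (Unique.filter⁺ (incident? v) (edges-unique G)) to from))
      (sym (sum-indicator (incident? v) (edges G))))
      where
      neighbours : List (Fin n)
      neighbours = filter (adj? G v) (allFin n)

      injective : ∀ {u w} → edgeBetween v u ≡ edgeBetween v w → u ≡ w
      injective {u} {w} eq =
        ends-unique (edgeBetween-ends v u) (subst (λ e → Ends e v w) (sym eq) (edgeBetween-ends v w))

      to : ∀ {e} → e ∈ map (edgeBetween v) neighbours → e ∈ filter (incident? v) (edges G)
      to e∈ with ∈-map⁻ (edgeBetween v) e∈
      ... | u , u∈ , refl = ∈-filter⁺ (incident? v)
        (edgeBetween-∈ (proj₂ (∈-filter⁻ (adj? G v) {xs = allFin n} u∈))) (endsˡ (edgeBetween-ends v u))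

      from : ∀ {e} → e ∈ filter (incident? v) (edges G) → e ∈ map (edgeBetween v) neighbours
      from {e} e∈ with ∈-filter⁻ (incident? v) {xs = edges G} e∈
      ... | e∈′ , i with otherEnd i
      ...   | u , ends = subst (_∈ map (edgeBetween v) neighbours) (sym (edgeBetween-unique e∈′ ends))
        (∈-map⁺ (edgeBetween v) (∈-filter⁺ (adj? G v) (∈-allFin u) (adj ends)))
        where
        adj : Ends e v u → Adj G v u
        adj (inj₁ refl) = joined-adj (inj₁ e∈′)
        adj (inj₂ refl) = joined-adj (inj₂ e∈′)

  ∏degree!≡∏deg! : ∏degree! G ≡ ∏deg! (edges G)
  ∏degree!≡∏deg! = trans (product-cong (allFin n) (λ v _ → cong _! (degree≡deg v))) (sym (∏deg!-def (edges G)))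

  -- A simple walk from `x` to `y` in `es` with at least two steps would close to a cycle through
  -- `xy`. So it has one step, and the fixed orientation makes that step the pair itself.
  closing-edge : IsAcyclic G → ∀ {es x y} → (∀ {e} → e ∈ es → e ∈ edges G) →
                 FormConnected es → Covered es x → Covered es y → (x , y) ∈ edges G → (x , y) ∈ es
  closing-edge acyclic {es} {x} {y} sub c cx cy xy∈ with simpleWalk (c x y cx cy)
  ... | [] , _ , [] = contradiction (proj₁ (∈-edges⁻ xy∈)) (Fin.<-irrefl refl)
  ... | _ ∷ [] , _ , inj₁ e∈ ∷ [] = e∈
  ... | _ ∷ [] , _ , inj₂ e∈ ∷ [] = contradiction (proj₁ (∈-edges⁻ xy∈)) (Fin.<-asym (proj₁ (∈-edges⁻ (sub e∈))))
  ... | ws@(_ ∷ _ ∷ _) , u , wk = contradiction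
    (s≤s (s≤s z≤n) , u , walk-linked (joined-adj ∘ Sum.map sub sub) wk (joined-adj (inj₂ xy∈)))
    (acyclic x ws)

  -- Growing a subtree edge by edge: it ends up spanning, and then acyclicity leaves no edge over.
  grow-subtree : IsTree G → ∀ k {es rest} → length rest ≡ k → edges G ↭ es ++ rest → Tree es →
                 Tree (edges G) × (∀ v → Covered (edges G) v)
  grow-subtree isTree@(connected , acyclic) k {es} {rest} len p t
    with Fin.any? (λ v → ¬? (covered? es v))
  ... | yes (v , ¬cv) = extend k len
    where
    start = nonempty-covered λ { refl → tree-nonempty t }

    new-edge : ∃₂ λ e r → Grows es e × rest ↭ e ∷ r
    new-edge with crossing (covered? es) (connected (proj₁ start) v) (proj₂ start) ¬cv
    ... | u , w , adj , cu , ¬cw with edgeBetween-ends u w | Perm.∈-resp-↭ p (edgeBetween-∈ adj)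
    ...   | ends | e∈ with ∈-++⁻ es e∈
    ...     | inj₁ e∈es   = contradiction (covered⁺ e∈es (endsʳ ends)) ¬cw
    ...     | inj₂ e∈rest = let r , q = ∈⇒↭ e∈rest in _ , r , grows ends cu ¬cw , q

    extend : ∀ k → length rest ≡ k → Tree (edges G) × (∀ v → Covered (edges G) v)
    extend k len with new-edge
    extend zero    len | e , r , g , q = contradiction (trans (sym (Perm.↭-length q)) len) λ ()
    extend (suc k) len | e , r , g , q = grow-subtree isTree k
      (ℕ.suc-injective (trans (sym (Perm.↭-length q)) len))
      (↭-trans p (↭-trans (Perm.++⁺ˡ es q) (Perm.shift e es r)))
      (grow t g ↭-refl)
  ... | no ¬uncovered = finish rest p
    where
    covered : ∀ v → Covered es v
    covered v = decidable-stable (covered? es v) (λ ¬c → ¬uncovered (v , ¬c))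

    finish : ∀ rest → edges G ↭ es ++ rest → Tree (edges G) × (∀ v → Covered (edges G) v)
    finish [] p = tree-resp-↭ q t , covered-resp-↭ q ∘ covered
      where q = ↭-trans (↭-reflexive (sym (List.++-identityʳ es))) (↭-sym p)
    finish (e ∷ r) p = contradiction
      (∈-++⁺ˡ (closing-edge acyclic (Perm.∈-resp-↭ (↭-sym p) ∘ ∈-++⁺ˡ) (tree-connected t) (covered _) (covered _)
        (Perm.∈-resp-↭ (↭-sym p) (∈-++⁺ʳ es (here refl)))))
      (Unique[x∷xs]⇒x∉xs (Unique-resp-↭ (↭-trans p (Perm.shift e es r)) (edges-unique G)))

tree-edges : ∀ {n} → 2 ≤ n → (G : Graph n) → IsTree G → Tree (edges G) × (∀ v → Covered (edges G) v)
-- Any edge can start the growth; this takes the first one on a walk between two distinct vertices.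
tree-edges (s≤s (s≤s z≤n)) G isTree@(connected , _) with connected Fin.zero (Fin.suc Fin.zero)
... | adj ◅ _ with adj-joined G adj
...   | inj₁ e∈ = let r , p = ∈⇒↭ e∈ in
  grow-subtree G isTree _ refl p (single (λ { refl → irrefl G refl adj }))
...   | inj₂ e∈ = let r , p = ∈⇒↭ e∈ in
  grow-subtree G isTree _ refl p (single (λ { refl → irrefl G refl adj }))

-- Paths and stars up to isomorphism

open Graph

unique-constant-length : ∀ {A : Set} {xs : List A} → Unique xs →
  (∀ {x y} → x ∈ xs → y ∈ xs → x ≡ y) → length xs ≤ 1
unique-constant-length {xs = []}         _                     _ = z≤n
unique-constant-length {xs = _ ∷ []}     _                     _ = s≤s z≤n
unique-constant-length {xs = _ ∷ _ ∷ _} ((x≢ All.∷ _) ∷ _) eq =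
  contradiction (eq (here refl) (there (here refl))) x≢

length≡1-constant : ∀ {A : Set} {xs : List A} {x y} → length xs ≡ 1 → x ∈ xs → y ∈ xs → x ≡ y
length≡1-constant {xs = _ ∷ []} _ (here refl) (here refl) = refl

transposeˡ : ∀ {n} (i j : Fin n) → transpose i j ⟨$⟩ʳ i ≡ j
transposeˡ i j rewrite dec-true (i Fin.≟ i) refl = refl

module _ {n : ℕ} (G : Graph n) where

  deg≤1 : ∀ {v} → (∀ {u w} → Adj G v u → Adj G v w → u ≡ w) → deg (edges G) v ≤ 1
  deg≤1 {v} same = subst (_≤ 1) (degree≡deg G v)
    (unique-constant-length (Unique.filter⁺ (adj? G v) (Unique.allFin⁺ n))
      (λ u∈ w∈ → same (proj₂ (∈-filter⁻ (adj? G v) {xs = allFin n} u∈)) (proj₂ (∈-filter⁻ (adj? G v) {xs = allFin n} w∈))))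

  deg≡1-neighbour : ∀ {v u w} → deg (edges G) v ≡ 1 → Adj G v u → Adj G v w → u ≡ w
  deg≡1-neighbour {v} {u} {w} d vu vw = length≡1-constant (trans (degree≡deg G v) d)
    (∈-filter⁺ (adj? G v) (∈-allFin u) vu) (∈-filter⁺ (adj? G v) (∈-allFin w) vw)

  edge-adj : ∀ {e u v} → e ∈ edges G → Ends e u v → Adj G u v
  edge-adj e∈ (inj₁ refl) = joined-adj G (inj₁ e∈)
  edge-adj e∈ (inj₂ refl) = joined-adj G (inj₂ e∈)

  adj-edge : ∀ {u v} → Adj G u v → ∃ λ e → e ∈ edges G × Ends e u v
  adj-edge adj with adj-joined G adj
  ... | inj₁ e∈ = _ , e∈ , inj₁ refl
  ... | inj₂ e∈ = _ , e∈ , inj₂ refl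

  IsStar⇒starAt : 1 ≤ n → IsStar G → ∃ (StarAt (edges G))
  IsStar⇒starAt (s≤s _) (π , iso) = c , star
    where
    c = π ⟨$⟩ˡ Fin.zero

    centre : ∀ {v} → toℕ (π ⟨$⟩ʳ v) ≡ 0 → v ≡ c
    centre eq = trans (sym (Permutation.inverseˡ π)) (cong (π ⟨$⟩ˡ_) (Fin.toℕ-injective eq))

    to-centre : ∀ {u v} → toℕ (π ⟨$⟩ʳ u) ≢ 0 → Adj G u v → v ≡ c
    to-centre ≢0 adj with Equivalence.to (iso _ _) adj
    ... | inj₁ (≡0 , _) = contradiction ≡0 ≢0
    ... | inj₂ (≡0 , _) = centre ≡0

    leaf : ∀ {u v} → toℕ (π ⟨$⟩ʳ v) ≢ 0 → Adj G u v → deg (edges G) v ≡ 1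
    leaf ≢0 adj = ℕ.≤-antisym (deg≤1 (λ vu vw → trans (to-centre ≢0 vu) (sym (to-centre ≢0 vw))))
      (deg-covered (edges G) (joined-covered (adj-joined G (symm G adj))))

    star : StarAt (edges G) c
    star {i , j} e∈ with joined-adj G (inj₁ e∈)
    ... | adj with Equivalence.to (iso i j) adj
    ...   | inj₁ (≡0 , ≢0) = j , subst (λ v → Ends (i , j) v j) (centre ≡0) (inj₁ refl) , leaf ≢0 adj
    ...   | inj₂ (≡0 , ≢0) = i , subst (λ v → Ends (i , j) v i) (centre ≡0) (inj₂ refl) , leaf ≢0 (symm G adj)

  -- Adjacency in the standard star depends only on which vertex is 0, so any permutation taking `c`
  -- to 0 will do; a transposition is the simplest.
  starAt⇒IsStar : 1 ≤ n → (∀ v → Covered (edges G) v) → ∀ {c} → StarAt (edges G) c → IsStar G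
  starAt⇒IsStar (s≤s _) covered {c} star = π , λ u v → mk⇔ to from
    where
    π = transpose c Fin.zero

    π-c : π ⟨$⟩ʳ c ≡ Fin.zero
    π-c = transposeˡ c Fin.zero

    at-centre : ∀ {u} → u ≡ c → toℕ (π ⟨$⟩ʳ u) ≡ 0
    at-centre refl = cong toℕ π-c

    centre : ∀ {u} → toℕ (π ⟨$⟩ʳ u) ≡ 0 → u ≡ c
    centre {u} eq = trans (sym (Permutation.inverseˡ π))
      (trans (cong (π ⟨$⟩ˡ_) (trans (Fin.toℕ-injective eq) (sym π-c))) (Permutation.inverseˡ π))

    from-centre : ∀ {v} → v ≢ c → Adj G c v
    from-centre {v} v≢c with covered⁻ (covered v)
    ... | e , e∈ , i with star e∈
    ...   | x , ends , _ with incident-ends ends i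
    ...     | inj₁ v≡c  = contradiction v≡c v≢c
    ...     | inj₂ refl = edge-adj e∈ ends

    to : ∀ {u v} → Adj G u v → Adj (starGraph n) (π ⟨$⟩ʳ u) (π ⟨$⟩ʳ v)
    to {u} {v} adj with adj-edge adj
    ... | e , e∈ , ends with star e∈
    ...   | x , ends′ , _ with incident-ends ends (endsˡ ends′)
    ...     | inj₁ c≡u = inj₁ (at-centre (sym c≡u) , λ ≡0 → irrefl G (trans (sym c≡u) (sym (centre ≡0))) adj)
    ...     | inj₂ c≡v = inj₂ (at-centre (sym c≡v) , λ ≡0 → irrefl G (trans (centre ≡0) c≡v) adj)

    from : ∀ {u v} → Adj (starGraph n) (π ⟨$⟩ʳ u) (π ⟨$⟩ʳ v) → Adj G u v
    from (inj₁ (≡0 , ≢0)) = subst (λ u → Adj G u _) (sym (centre ≡0)) (from-centre (≢0 ∘ at-centre))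
    from (inj₂ (≡0 , ≢0)) = symm G (subst (λ v → Adj G v _) (sym (centre ≡0)) (from-centre (≢0 ∘ at-centre)))

  layout⇒IsPath : (∀ v → Covered (edges G) v) → PathLayout (edges G) → IsPath G
  layout⇒IsPath covered L = permutation f g f-g g-f , λ u v → mk⇔ to from
    where
    open PathLayout L
    m = length (edges G)

    pos-injective : ∀ {u v} → pos u ≡ pos v → u ≡ v
    pos-injective {u} {v} eq = trans (sym (at-pos (covered u))) (trans (cong at eq) (at-pos (covered v)))

    -- Injections both ways: `pos` from vertices to positions, `at` from positions to vertices.
    n≡ : n ≡ suc m
    n≡ = ℕ.≤-antisym
      (Fin.injective⇒≤ {f = λ v → fromℕ< (s≤s (pos-≤ (covered v)))}
        (λ eq → pos-injective (Fin.fromℕ<-injective _ _ _ _ eq)))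
      (Fin.injective⇒≤ {f = at ∘ toℕ} (λ {i} {j} eq → Fin.toℕ-injective
        (trans (sym (pos-at (Fin.toℕ≤pred[n] i))) (trans (cong pos eq) (pos-at (Fin.toℕ≤pred[n] j))))))

    f : Fin n → Fin n
    f v = fromℕ< (subst (pos v <_) (sym n≡) (s≤s (pos-≤ (covered v))))

    g : Fin n → Fin n
    g i = at (toℕ i)

    toℕ-f : ∀ v → toℕ (f v) ≡ pos v
    toℕ-f v = Fin.toℕ-fromℕ< _

    f-g : ∀ i → f (g i) ≡ i
    f-g i = Fin.toℕ-injective (trans (toℕ-f (g i))
      (pos-at (s≤s⁻¹ (subst (toℕ i <_) n≡ (Fin.toℕ<n i)))))

    g-f : ∀ v → g (f v) ≡ v
    g-f v = trans (cong at (toℕ-f v)) (at-pos (covered v))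

    to : ∀ {u v} → Adj G u v → Adj (pathGraph n) (f u) (f v)
    to {u} {v} adj rewrite toℕ-f u | toℕ-f v = joined-pos (adj-joined G adj)

    next : ∀ {u v} → pos v ≡ suc (pos u) → Adj G u v
    next {u} {v} eq = subst₂ (Adj G) (at-pos (covered u)) (trans (cong at (sym eq)) (at-pos (covered v)))
      (joined-adj G (at-joined (subst (_≤ m) eq (pos-≤ (covered v)))))

    from : ∀ {u v} → Adj (pathGraph n) (f u) (f v) → Adj G u v
    from {u} {v} adj rewrite toℕ-f u | toℕ-f v with adj
    ... | inj₁ eq = next eq
    ... | inj₂ eq = symm G (next eq)

IsPath⇒atMostTwoLeaves : ∀ {n} (G : Graph n) → 1 ≤ n → IsPath G → AtMostTwoLeaves (edges G)
IsPath⇒atMostTwoLeaves {suc n} G _ (π , iso) = atMostTwoLeaves {a = a} {b} deg-a deg-b leaf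
  where
  at : Fin (suc n) → Fin (suc n)
  at = π ⟨$⟩ˡ_

  pos : Fin (suc n) → ℕ
  pos v = toℕ (π ⟨$⟩ʳ v)

  a = at Fin.zero
  b = at (fromℕ n)

  pos-at : ∀ i → pos (at i) ≡ toℕ i
  pos-at i = cong toℕ (Permutation.inverseʳ π)

  pos-injective : ∀ {u v} → pos u ≡ pos v → u ≡ v
  pos-injective eq = trans (sym (Permutation.inverseˡ π))
    (trans (cong (π ⟨$⟩ˡ_) (Fin.toℕ-injective eq)) (Permutation.inverseˡ π))

  next-to-first : ∀ {u} → Adj G a u → pos u ≡ 1
  next-to-first adj with Equivalence.to (iso _ _) adj
  ... | inj₁ eq = trans eq (cong suc (pos-at Fin.zero))
  ... | inj₂ eq = contradiction (trans (sym (pos-at Fin.zero)) eq) λ ()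

  next-to-last : ∀ {u} → Adj G b u → suc (pos u) ≡ n
  next-to-last {u} adj with Equivalence.to (iso _ _) adj
  ... | inj₁ eq = contradiction (trans eq (cong suc (trans (pos-at (fromℕ n)) (Fin.toℕ-fromℕ n))))
                    (ℕ.<⇒≢ (Fin.toℕ<n (π ⟨$⟩ʳ u)))
  ... | inj₂ eq = trans (sym eq) (trans (pos-at (fromℕ n)) (Fin.toℕ-fromℕ n))

  deg-a : deg (edges G) a ≤ 1
  deg-a = deg≤1 G λ au aw → pos-injective (trans (next-to-first au) (sym (next-to-first aw)))

  deg-b : deg (edges G) b ≤ 1
  deg-b = deg≤1 G λ bu bw → pos-injective (ℕ.suc-injective (trans (next-to-last bu) (sym (next-to-last bw))))

  leaf : ∀ {v} → deg (edges G) v ≡ 1 → v ≡ a ⊎ v ≡ b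
  leaf {v} d with π ⟨$⟩ʳ v in eq
  ... | Fin.zero  = inj₁ (pos-injective (trans (cong toℕ eq) (sym (pos-at Fin.zero))))
  ... | Fin.suc i with suc (toℕ i) ℕ.≟ n
  ...   | yes last = inj₂ (pos-injective (trans (cong toℕ eq) (trans last (sym (trans (pos-at (fromℕ n)) (Fin.toℕ-fromℕ n))))))
  -- An inner vertex at position i + 1 has neighbours at i and i + 2, which a vertex of degree 1
  -- would have to identify.
  ...   | no ¬last = contradiction (trans (sym pos-u) (trans (cong pos (deg≡1-neighbour G d vu vw)) pos-w))
                       (ℕ.<⇒≢ (ℕ.m<n⇒m<1+n (ℕ.n<1+n (toℕ i))))
    where
    i+2< : suc (suc (toℕ i)) < suc n
    i+2< = s≤s (ℕ.≤∧≢⇒< (Fin.toℕ<n i) ¬last)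

    u = at (inject₁ i)
    w = at (fromℕ< i+2<)

    pos-v : pos v ≡ suc (toℕ i)
    pos-v = cong toℕ eq

    pos-u : pos u ≡ toℕ i
    pos-u = trans (pos-at (inject₁ i)) (Fin.toℕ-inject₁ i)

    pos-w : pos w ≡ suc (suc (toℕ i))
    pos-w = trans (pos-at (fromℕ< i+2<)) (Fin.toℕ-fromℕ< i+2<)

    vu : Adj G v u
    vu = Equivalence.from (iso v u) (inj₂ (trans pos-v (cong suc (sym pos-u))))

    vw : Adj G v w
    vw = Equivalence.from (iso v w) (inj₁ (trans pos-w (cong suc (sym pos-v))))

deg-≤-length : ∀ {n} (es : List (Edge n)) v → deg es v ≤ length es
deg-≤-length []       v = ℕ.≤-reflexive (deg-[] v)
deg-≤-length (e ∷ es) v with incident? v e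
... | yes i = subst (_≤ suc (length es)) (sym (deg-∷ es i)) (s≤s (deg-≤-length es v))
... | no ¬i = subst (_≤ suc (length es)) (sym (deg-∷-other es ¬i)) (ℕ.m≤n⇒m≤1+n (deg-≤-length es v))

tree-length : ∀ {n} {es : List (Edge n)} → Tree es → ∃ λ m → length es ≡ suc m
tree-length {es = []}     t = contradiction t tree-nonempty
tree-length {es = _ ∷ es} t = length es , refl

tight-tree : ∀ {n} {es : List (Edge n)} → Tree es → count es ≡ ∏deg! es → PathLayout es ⊎ ∃ (StarAt es)
tight-tree {es = es} t eq with star⊎twoNearLeaves t | layout⊎threeLeaves t
... | inj₁ star | _         = inj₂ star
... | inj₂ _    | inj₁ path = inj₁ path
-- The degree of the near-leaf `a` supplies the two edges that `count-strict` asks for.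
... | inj₂ nl@(a , _ , _ , (_ , d≥2 , _) , _) | inj₂ tl =
  contradiction (sym eq) (ℕ.<⇒≢ (count-strict (sym (ℕ.m+[n∸m]≡n (ℕ.≤-trans d≥2 (deg-≤-length es a)))) t nl tl))

theorem3p8 : ∀ (n : ℕ) → 2 ≤ n → (T : Graph n) → IsTree T →
    (F T ≥ ∏degree! T) × ((F T ≡ ∏degree! T) ⇔ (IsPath T ⊎ IsStar T))
theorem3p8 n 2≤n T isTree with tree-edges 2≤n T isTree
... | t , covered with tree-length t
...   | m , len rewrite F≡count T | ∏degree!≡∏deg! T = lower , mk⇔ to (λ ps → ℕ.≤-antisym (upper ps) lower)
  where
  lower : ∏deg! (edges T) ≤ count (edges T)
  lower = count-lower m len t

  1≤n : 1 ≤ n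
  1≤n = ℕ.<⇒≤ 2≤n

  to : count (edges T) ≡ ∏deg! (edges T) → IsPath T ⊎ IsStar T
  to eq = Sum.map (layout⇒IsPath T covered) (λ (_ , s) → starAt⇒IsStar T 1≤n covered s) (tight-tree t eq)

  upper : IsPath T ⊎ IsStar T → count (edges T) ≤ ∏deg! (edges T)
  upper (inj₁ path) = count-path m len t (IsPath⇒atMostTwoLeaves T 1≤n path)
  upper (inj₂ star) = count-star m len t (proj₂ (IsStar⇒starAt T 1≤n star))
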